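{- Let $n, d, r, \ell$ be integers with $r \geq 2$ and $0 \leq \ell < d \leq \left\lfloor \frac{n+\ell-1}{2} \right\rfloor$. If $G$ is an $n$-vertex graph with minimum degree $\delta(G) \geq d$ and $G$ is not $\ell$-hamiltonian, then $$N(G, K_r) \leq \max\left\{ h_r(n,d,\ell),\; h_r\left(n, \left\lfloor \tfrac{n+\ell-1}{2} \right\rfloor, \ell\right)\right\}.$$ In particular (the case $r=2$), $$|E(G)| \leq \max\left\{ h(n,d,\ell),\; h\left(n, \left\lfloor \tfrac{n+\ell-1}{2} \right\rfloor, \ell\right)\right\}.$$ Moreover, the bound is sharp for all $0 \leq \ell < d \leq \left\lfloor \frac{n+\ell-1}{2} \right\rfloor$, as shown by the graphs $H_{n,d,\ell}$ and $H_{n,\lfloor (n+\ell-1)/2\rfloor,\ell}$: each of these is an $n$-vertex graph with minimum degree at least $d$ that is not $\ell$-hamiltonian, and one of them contains exactly $\max\left\{ h_r(n,d,\ell), h_r\left(n, \left\lfloor \frac{n+\ell-1}{2} \right\rfloor, \ell\right)\right\}$ copies of $K_r$.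
   Context: All graphs are finite and simple. A linear forest is a graph that is a vertex-disjoint union of paths. For an integer $\ell\ge 0$, a graph $G$ is called $\ell$-hamiltonian if for every linear forest $F$ with exactly $\ell$ edges contained in $G$, $G$ has a hamiltonian cycle containing all edges of $F$ (so $0$-hamiltonian means hamiltonian). $N(G,K_r)$ denotes the number of copies of the complete graph $K_r$ in $G$ (i.e. the number of $r$-element vertex subsets inducing a clique); in particular $N(G,K_2)=|E(G)|$. For integers $0\le \ell<d\le \lfloor (n+\ell-1)/2\rfloor$, the graph $H_{n,d,\ell}$ is the $n$-vertex graph obtained from a copy of $K_{n-d+\ell}$ with vertex set $A$ by adding $d-\ell$ new vertices, each of degree $d$ and each adjacent to exactly the vertices of one common fixed set $B\subseteq A$ with $|B|=d$ (the new vertices are pairwise non-adjacent). The function $h_r$ is defined by $h_r(n,d,\ell) = \binom{n-d+\ell}{r} + (d-\ell)\binom{d}{r-1}$, which equals $N(H_{n,d,\ell},K_r)$, and $h(n,d,\ell) = h_2(n,d,\ell)=\binom{n-d+\ell}{2}+(d-\ell)d$, which equals $|E(H_{n,d,\ell})|$. -}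

module Defs where

open import Data.Fin.Base using (Fin; toℕ)
import Data.Fin.Base as Fin
open import Data.Fin.Properties using (all?)
import Data.Fin.Properties as Fin
open import Data.Fin.Subset using (Subset; inside; outside; ∣_∣)
import Data.Fin.Subset as Subset
import Data.Fin.Subset.Properties as Subset
open import Data.List.Base
  using (List; []; _∷_; _++_; _∷ʳ_; [_]; map; filter; length; concat; allFin; cartesianProduct)
open import Data.List.Extrema.Nat using (min)
open import Data.List.Membership.Propositional using (_∈_)
open import Data.List.Relation.Unary.Any using (Any)
open import Data.List.Relation.Unary.Linked using (Linked)
open import Data.List.Relation.Unary.Unique.Propositional using (Unique)
open import Data.Nat.Base using (ℕ; zero; suc; _+_; _*_; _∸_; _≤_; _<_)
open import Data.Nat.Combinatorics using (_C_)
import Data.Nat.Properties as ℕ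
open import Data.Product.Base using (Σ-syntax; _×_; _,_)
open import Data.Sum.Base using (_⊎_; inj₁; inj₂)
import Data.Vec.Base as Vec
open import Function.Bundles using (_⇔_)
open import Level using (0ℓ)
open import Relation.Binary.Core using (Rel)
open import Relation.Binary.Definitions using (Decidable; Symmetric; Irreflexive)
open import Relation.Binary.PropositionalEquality using (_≡_; _≢_; ≢-sym)
open import Relation.Nullary.Decidable using (Dec; _×-dec_; _⊎-dec_; _→-dec_; ¬?)
open import Relation.Nullary.Negation using (¬_)

private
  variable
    n : ℕ

record Graph (n : ℕ) : Set₁ where
  field
    Adj    : Rel (Fin n) 0ℓ
    adj?   : Decidable Adj
    sym    : Symmetric Adj
    irrefl : Irreflexive _≡_ Adj

open Graph public using (Adj; adj?)

infix 4 _⊆ᴳ_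

_⊆ᴳ_ : Graph n → Graph n → Set
F ⊆ᴳ G = ∀ {u v} → Adj F u v → Adj G u v

degree : Graph n → Fin n → ℕ
degree {n} G v = length (filter (adj? G v) (allFin n))

-- Every degree is less than n, so the seed n of the minimum matters only when
-- there are no vertices.
δ : Graph n → ℕ
δ {n} G = min n (map (degree G) (allFin n))

∣E_∣ : Graph n → ℕ
∣E_∣ {n} G =
  length (filter (λ (u , v) → (u Fin.<? v) ×-dec adj? G u v)
                 (cartesianProduct (allFin n) (allFin n)))

IsClique : Graph n → Subset n → Set
IsClique G S = ∀ u v → u Subset.∈ S → v Subset.∈ S → u ≢ v → Adj G u v

isClique? : (G : Graph n) (S : Subset n) → Dec (IsClique G S)
isClique? G S = all? λ u → all? λ v →
  (u Subset.∈? S) →-dec ((v Subset.∈? S) →-dec (¬? (u Fin.≟ v) →-dec adj? G u v))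

subsets : (n : ℕ) → List (Subset n)
subsets zero    = [ Vec.[] ]
subsets (suc n) = map (inside Vec.∷_) (subsets n) ++ map (outside Vec.∷_) (subsets n)

-- N G r is N(G , K_r).
N : Graph n → ℕ → ℕ
N {n} G r = length (filter (λ S → (∣ S ∣ ℕ.≟ r) ×-dec isClique? G S) (subsets n))

data Step {A : Set} (u v : A) : List A → Set where
  here  : ∀ {xs} → Step u v (u ∷ v ∷ xs)
  there : ∀ {x xs} → Step u v xs → Step u v (x ∷ xs)

-- uv is an edge of the walk with the given vertex sequence.
Traverses : {A : Set} → A → A → List A → Set
Traverses u v xs = Step u v xs ⊎ Step v u xs

-- The paths are given by their vertex sequences. They cover all vertices, so
-- an isolated vertex is a path on its own.
record IsLinearForest (F : Graph n) : Set where
  field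
    paths    : List (List (Fin n))
    disjoint : Unique (concat paths)
    covering : ∀ v → v ∈ concat paths
    edges    : ∀ u v → Adj F u v ⇔ Any (Traverses u v) paths

record HamiltonianCycle (G : Graph n) : Set where
  field
    start    : Fin n
    rest     : List (Fin n)

  closedWalk : List (Fin n)
  closedWalk = start ∷ (rest ∷ʳ start)

  field
    atLeast3 : 3 ≤ n
    distinct : Unique (start ∷ rest)
    spanning : ∀ v → v ∈ start ∷ rest
    adjacent : Linked (Adj G) closedWalk

open HamiltonianCycle public using (closedWalk)

-- A linear forest contained in G may be taken to have all vertices of G, by
-- adding one-vertex paths, which changes neither its edges nor their number.
Hamiltonian : ℕ → Graph n → Set₁
Hamiltonian {n} ℓ G =
  (F : Graph n) → IsLinearForest F → ∣E F ∣ ≡ ℓ → F ⊆ᴳ G →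
  Σ[ c ∈ HamiltonianCycle G ] (∀ u v → Adj F u v → Traverses u v (closedWalk c))

hᵣ : (r n d ℓ : ℕ) → ℕ
hᵣ r n d ℓ = ((n ∸ d + ℓ) C r) + (d ∸ ℓ) * (d C (r ∸ 1))

h : (n d ℓ : ℕ) → ℕ
h = hᵣ 2

-- The graph H_{n,d,ℓ}, for ℓ < d ≤ ⌊(n+ℓ-1)/2⌋: A consists of the first
-- n - d + ℓ vertices, B of the first d, and the remaining d - ℓ are the new ones.
module _ (n d ℓ : ℕ) where

  InA InB New : Fin n → Set
  InA v = toℕ v < n ∸ d + ℓ
  InB v = toℕ v < d
  New v = ¬ InA v

  HAdj : Rel (Fin n) 0ℓ
  HAdj u v = u ≢ v × (InA u × InA v ⊎ InB u × New v ⊎ New u × InB v)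

  H : Graph n
  H = record
    { Adj    = HAdj
    ; adj?   = λ u v → ¬? (u Fin.≟ v) ×-dec
                 ((inA? u ×-dec inA? v) ⊎-dec
                  ((inB? u ×-dec ¬? (inA? v)) ⊎-dec (¬? (inA? u) ×-dec inB? v)))
    ; sym    = λ { (u≢v , inj₁ (a , b))        → ≢-sym u≢v , inj₁ (b , a)
                 ; (u≢v , inj₂ (inj₁ (a , b))) → ≢-sym u≢v , inj₂ (inj₂ (b , a))
                 ; (u≢v , inj₂ (inj₂ (a , b))) → ≢-sym u≢v , inj₂ (inj₁ (b , a)) }
    ; irrefl = λ u≡v (u≢v , _) → u≢v u≡v
    }
    where
    inA? : ∀ v → Dec (InA v)
    inA? v = toℕ v ℕ.<? (n ∸ d + ℓ)
    inB? : ∀ v → Dec (InB v)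
    inB? v = toℕ v ℕ.<? d

{-# OPTIONS --safe #-}
module Submission where

-- Let F be a linear forest with ℓ edges in G. If u, v are non-adjacent with
-- deg u + deg v ≥ n + ℓ, a hamiltonian cycle through F in G + uv can be rerouted
-- around uv by Ore's crossing argument: at least ℓ + 1 crossings are available,
-- and at most ℓ of them break an edge of F. So keep adding such edges. Either the
-- graph becomes complete, and then it has a cycle through F, or it gets stuck;
-- then a non-adjacent pair of maximum degree sum, deg u ≤ deg v, yields k − ℓ
-- vertices of degree at most k = deg u (non-neighbours of v), so that
-- N ≤ hᵣ(n, k, ℓ), and hᵣ is convex in k between d and ⌊(n+ℓ-1)/2⌋.
--
-- On a hamiltonian cycle of H through a path with ℓ edges inside B, the d arcs
-- into B are all taken by that path and by the d − ℓ new vertices, so no arc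
-- enters B from A ∖ B.

open import Defs
open import Data.Nat.Base using (ℕ; _+_; _∸_; _⊔_; _≤_; _<_; ⌊_/2⌋)
open import Data.Product.Base using (_×_)
open import Data.Sum.Base using (_⊎_)
open import Relation.Binary.PropositionalEquality using (_≡_)
open import Relation.Nullary.Negation using (¬_)

open import Data.Bool.Base using (true; false)
open import Data.Fin.Base as Fin using (Fin; zero; suc; toℕ; fromℕ<)
open import Data.Fin.Properties as Fin using (all?; toℕ-fromℕ<)
open import Data.Fin.Subset as Subset using (Subset; inside; outside; ∣_∣; ⁅_⁆)
import Data.Fin.Subset.Properties as Subset
open import Data.List.Base
  using (List; []; _∷_; _++_; _∷ʳ_; [_]; map; filter; length; concat; reverse; take; allFin; cartesianProduct)
open import Data.List.Extrema.Nat
  using (argmax; argmax-all; f[xs]≤f[argmax]; f[⊥]≤f[argmax]; min≤xs; v≤min⁺)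
open import Data.List.Membership.Propositional using (_∈_; _∉_; find; lose)
open import Data.List.Membership.Propositional.Properties
  using (∈-∃++; ∈-++⁺ˡ; ∈-++⁺ʳ; ∈-filter⁺; ∈-filter⁻; ∈-allFin; ∈-map⁺; ∈-map⁻; ∈-cartesianProduct⁺)
open import Data.List.Properties
  using (map-++; map-cong; map-∘; map-tabulate; length-tabulate; length-map; length-take;
         unfold-reverse; ++-assoc; filter-notAll; concat-map-[_])
open import Data.List.Relation.Binary.Permutation.Propositional
  using (_↭_; ↭-refl; ↭-trans; ↭-sym; prep; ↭⇒↭ₛ)
open import Data.List.Relation.Binary.Permutation.Propositional.Properties
  using (shift; ∈-resp-↭; map⁺; ++-comm; ↭-reverse; ++⁺ʳ)
import Data.List.Relation.Binary.Permutation.Setoid.Properties as Permutation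
open import Data.List.Relation.Binary.Subset.Propositional using (_⊆_)
open import Data.List.Relation.Unary.All as All using (All; []; _∷_)
import Data.List.Relation.Unary.All.Properties as All
open import Data.List.Relation.Unary.AllPairs using ([]; _∷_)
open import Data.List.Relation.Unary.Any using (Any; here; there; any?)
open import Data.List.Relation.Unary.Linked using (Linked; []; [-]; _∷_)
open import Data.List.Relation.Unary.Unique.Propositional using (Unique)
import Data.List.Relation.Unary.Unique.Propositional.Properties as Unique
open import Data.Nat.Base using (zero; suc; _*_; _≤′_; ≤′-refl; ≤′-step; z≤n; s≤s; z<s; s<s; s<s⁻¹; s≤s⁻¹)
open import Data.Nat.Combinatorics using (_C_; nCk+nC[k+1]≡[n+1]C[k+1]; k>n⇒nCk≡0)
open import Data.Nat.ListAction using (sum)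
open import Data.Nat.ListAction.Properties using (sum-++; sum-↭)
open import Data.Nat.Properties
open import Data.Nat.Tactic.RingSolver using (solve-∀)
open import Data.Product.Base using (Σ-syntax; ∃-syntax; _,_; proj₁; proj₂)
open import Data.Product.Properties using (≡-dec)
open import Data.Sum.Base as Sum using (inj₁; inj₂; [_,_]′)
import Data.Vec.Base as Vec
open Vec using (here; there)
open import Function.Base using (_∘_; id; case_of_)
open import Function.Bundles using (Equivalence; mk⇔)
open import Level using (0ℓ)
open import Relation.Binary.Core using (Rel)
open import Relation.Binary.Definitions using (Symmetric)
open import Relation.Binary.PropositionalEquality
  using (_≢_; refl; sym; trans; cong; cong₂; subst; subst₂; setoid; module ≡-Reasoning)
open import Relation.Nullary.Decidable
  using (Dec; yes; no; ¬?; _×-dec_; _⊎-dec_; _→-dec_; map′; toSum; decidable-stable)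
open import Relation.Nullary.Negation using (contradiction)
open import Relation.Unary using (Pred; Decidable)

-- The threshold n + ℓ comes from the crossing count: a hamiltonian path has n - 1 arcs, so a degree
-- sum of n + ℓ makes at least ℓ + 1 of them count for both ends. When no edge can be added, the
-- degree sum is at most n + ℓ - 1, so the smaller degree k is at most ⌊(n+ℓ-1)/2⌋, while k ≥ d by
-- the minimum degree: this is the interval on which convexity is applied. Containing F, having all
-- degrees at least d and having more cliques than the bound all survive the addition of an edge.
-- Hence the process runs under the assumption that the bound fails, and getting stuck contradicts
-- that assumption. The natural variable for convexity is j = k - ℓ, in which `hᵣ` reads C(n - j, r)
-- + j C(ℓ + j, r - 1). In H the count of arcs into B has no slack, so it decides each arc
-- separately: a cycle that meets the part of A outside B can never leave it, yet it has to visit B.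

private
  variable
    n : ℕ
    A B P Q : Set
    R S : Rel A 0ℓ
    s t u v x y : A
    xs ys : List A

-- Indicators and sums over lists

ind : Dec P → ℕ
ind (yes _) = 1
ind (no _)  = 0

ind-yes : (p? : Dec P) → P → ind p? ≡ 1
ind-yes (yes _) p = refl
ind-yes (no ¬p) p = contradiction p ¬p

ind-no : (p? : Dec P) → ¬ P → ind p? ≡ 0
ind-no (yes p) ¬p = contradiction p ¬p
ind-no (no _)  ¬p = refl

ind-≤ : (p? : Dec P) {m : ℕ} → (P → 1 ≤ m) → ind p? ≤ m
ind-≤ (yes p) f = f p
ind-≤ (no _)  f = z≤n

ind-mono : (p? : Dec P) (q? : Dec Q) → (P → Q) → ind p? ≤ ind q?
ind-mono p? q? f = ind-≤ p? (≤-reflexive ∘ sym ∘ ind-yes q? ∘ f)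

ind-cong : (p? : Dec P) (q? : Dec Q) → (P → Q) → (Q → P) → ind p? ≡ ind q?
ind-cong p? q? f g = ≤-antisym (ind-mono p? q? f) (ind-mono q? p? g)

ind≤1 : (p? : Dec P) → ind p? ≤ 1
ind≤1 p? = ind-≤ p? λ _ → ≤-refl

∑ : List A → (A → ℕ) → ℕ
∑ xs f = sum (map f xs)

∑-mono : (xs : List A) {f g : A → ℕ} → (∀ {x} → x ∈ xs → f x ≤ g x) → ∑ xs f ≤ ∑ xs g
∑-mono []       f≤g = z≤n
∑-mono (x ∷ xs) f≤g = +-mono-≤ (f≤g (here refl)) (∑-mono xs (f≤g ∘ there))

∑-cong : (xs : List A) {f g : A → ℕ} → (∀ x → f x ≡ g x) → ∑ xs f ≡ ∑ xs g
∑-cong xs f≡g = cong sum (map-cong f≡g xs)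

-- Turns the tight count of arcs into B, on a cycle of H, into a statement about each single arc.
∑-tight : {f g : A → ℕ} → (∀ {x} → x ∈ xs → f x ≤ g x) → ∑ xs g ≤ ∑ xs f →
          ∀ {x} → x ∈ xs → f x ≡ g x
∑-tight {xs = y ∷ xs} {f} {g} f≤g g≤f (here refl) =
  ≤-antisym (f≤g (here refl))
    (+-cancelʳ-≤ (∑ xs f) _ _ (≤-trans (+-monoʳ-≤ (g y) (∑-mono xs (f≤g ∘ there))) g≤f))
∑-tight {xs = y ∷ xs} {f} {g} f≤g g≤f (there x∈) =
  ∑-tight (f≤g ∘ there)
    (+-cancelˡ-≤ (f y) _ _ (≤-trans (+-monoˡ-≤ (∑ xs g) (f≤g (here refl))) g≤f)) x∈

∑-++ : (xs ys : List A) (f : A → ℕ) → ∑ (xs ++ ys) f ≡ ∑ xs f + ∑ ys f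
∑-++ xs ys f = trans (cong sum (map-++ f xs ys)) (sum-++ (map f xs) (map f ys))

∑-map : (xs : List A) (g : A → B) (f : B → ℕ) → ∑ (map g xs) f ≡ ∑ xs (f ∘ g)
∑-map xs g f = cong sum (sym (map-∘ xs))

∑-const : (xs : List A) (c : ℕ) → ∑ xs (λ _ → c) ≡ length xs * c
∑-const []       c = refl
∑-const (x ∷ xs) c = cong (c +_) (∑-const xs c)

∑-+ : (xs : List A) (f g : A → ℕ) → ∑ xs (λ x → f x + g x) ≡ ∑ xs f + ∑ xs g
∑-+ []       f g = refl
∑-+ (x ∷ xs) f g = trans (cong (f x + g x +_) (∑-+ xs f g)) (lemma (f x) (g x) (∑ xs f) (∑ xs g))
  where
  lemma : ∀ a b c d → a + b + (c + d) ≡ a + c + (b + d)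
  lemma = solve-∀

∑-swap : (xs : List A) (ys : List B) (f : A → B → ℕ) →
         ∑ xs (λ x → ∑ ys (f x)) ≡ ∑ ys (λ y → ∑ xs (λ x → f x y))
∑-swap []       ys f = sym (trans (∑-const ys 0) (*-zeroʳ (length ys)))
∑-swap (x ∷ xs) ys f = trans (cong (∑ ys (f x) +_) (∑-swap xs ys f)) (sym (∑-+ ys (f x) _))

∑-∈ : {f : A → ℕ} → x ∈ xs → f x ≤ ∑ xs f
∑-∈ (here refl) = m≤m+n _ _
∑-∈ (there x∈)  = ≤-trans (∑-∈ x∈) (m≤n+m _ _)

length-filter : {P : Pred A _} (P? : Decidable P) (xs : List A) →
                length (filter P? xs) ≡ ∑ xs (ind ∘ P?)
length-filter P? []       = refl
length-filter P? (x ∷ xs) with P? x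
... | yes p = cong suc (length-filter P? xs)
... | no ¬p = length-filter P? xs

length-filter-mono : {P Q : Pred A _} (P? : Decidable P) (Q? : Decidable Q) (xs : List A) →
                     (∀ {x} → P x → Q x) → length (filter P? xs) ≤ length (filter Q? xs)
length-filter-mono P? Q? xs P⇒Q = subst₂ _≤_ (sym (length-filter P? xs)) (sym (length-filter Q? xs))
  (∑-mono xs λ {x} _ → ind-mono (P? x) (Q? x) P⇒Q)

-- Each entry of `xs` is taken out of `ys` once; as `xs` has no repetitions, its remaining entries
-- are still found in what is left. All comparisons of sums and lengths between lists rest on this.
unique-⊆⇒↭ : Unique xs → xs ⊆ ys → ∃[ zs ] ys ↭ xs ++ zs
unique-⊆⇒↭ {xs = []}     {ys} []          xs⊆ys = ys , ↭-refl
unique-⊆⇒↭ {xs = x ∷ xs} {ys} (x≢ ∷ uniq) xs⊆ys with ∈-∃++ (xs⊆ys (here refl))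
... | as , bs , refl with unique-⊆⇒↭ {ys = as ++ bs} uniq xs⊆
  where
  xs⊆ : xs ⊆ as ++ bs
  xs⊆ z∈ with ∈-resp-↭ (shift x as bs) (xs⊆ys (there z∈))
  ... | here refl = contradiction refl (All.lookup x≢ z∈)
  ... | there z∈' = z∈'
... | zs , perm = zs , ↭-trans (shift x as bs) (prep x perm)

∑-⊆ : {f : A → ℕ} → Unique xs → xs ⊆ ys → ∑ xs f ≤ ∑ ys f
∑-⊆ {xs = xs} {ys} {f} uniq xs⊆ys with unique-⊆⇒↭ uniq xs⊆ys
... | zs , perm = begin
  ∑ xs f            ≤⟨ m≤m+n _ _ ⟩
  ∑ xs f + ∑ zs f   ≡⟨ ∑-++ xs zs f ⟨
  ∑ (xs ++ zs) f    ≡⟨ sum-↭ (map⁺ f perm) ⟨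
  ∑ ys f            ∎
  where open ≤-Reasoning

∑-≈ : {f : A → ℕ} → Unique xs → Unique ys → xs ⊆ ys → ys ⊆ xs → ∑ xs f ≡ ∑ ys f
∑-≈ ux uy xs⊆ys ys⊆xs = ≤-antisym (∑-⊆ ux xs⊆ys) (∑-⊆ uy ys⊆xs)

length-∑ : (xs : List A) → length xs ≡ ∑ xs (λ _ → 1)
length-∑ xs = sym (trans (∑-const xs 1) (*-identityʳ (length xs)))

length-⊆ : Unique xs → xs ⊆ ys → length xs ≤ length ys
length-⊆ {xs = xs} {ys} uniq xs⊆ys =
  subst₂ _≤_ (sym (length-∑ xs)) (sym (length-∑ ys)) (∑-⊆ uniq xs⊆ys)

-- Counting vertices and vertex sets

# : {P : Pred (Fin n) 0ℓ} → Decidable P → ℕ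
# {n} P? = ∑ (allFin n) (ind ∘ P?)

∑-allFin : (f : Fin (suc n) → ℕ) → ∑ (allFin (suc n)) f ≡ f zero + ∑ (allFin n) (f ∘ suc)
∑-allFin f = cong (f zero +_) (cong sum (trans (map-tabulate suc f) (sym (map-tabulate id (f ∘ suc)))))

#-≡ : (v : Fin n) → # (Fin._≟ v) ≡ 1
#-≡ {n} v = ≤-antisym
  (subst (_≤ 1) (length-filter (Fin._≟ v) (allFin n))
    (length-⊆ {ys = [ v ]} (Unique.filter⁺ (Fin._≟ v) (Unique.allFin⁺ n))
      (λ x∈ → here (proj₂ (∈-filter⁻ (Fin._≟ v) {xs = allFin n} x∈)))))
  (≤-trans (≤-reflexive (sym (ind-yes (v Fin.≟ v) refl))) (∑-∈ (∈-allFin v)))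

#-¬ : {P : Pred (Fin n) 0ℓ} (P? : Decidable P) → # P? + # (¬? ∘ P?) ≡ n
#-¬ {n} P? = begin
  # P? + # (¬? ∘ P?)                                   ≡⟨ ∑-+ (allFin n) _ _ ⟨
  ∑ (allFin n) (λ v → ind (P? v) + ind (¬? (P? v)))    ≡⟨ ∑-cong (allFin n) (λ v → excluded-middle (P? v)) ⟩
  ∑ (allFin n) (λ _ → 1)                               ≡⟨ length-∑ (allFin n) ⟨
  length (allFin n)                                    ≡⟨ length-tabulate id ⟩
  n                                                    ∎
  where
  open ≡-Reasoning
  excluded-middle : {P : Set} (p? : Dec P) → ind p? + ind (¬? p?) ≡ 1
  excluded-middle (yes _) = refl
  excluded-middle (no _)  = refl

#-< : {t : ℕ} → t ≤ n → # {n} (λ v → toℕ v <? t) ≡ t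
#-< {zero}  z≤n = refl
#-< {suc n} {zero}  _ = begin
  # {suc n} (λ v → toℕ v <? 0)                                 ≡⟨ ∑-cong (allFin (suc n)) (λ v → ind-no (toℕ v <? 0) λ ()) ⟩
  ∑ (allFin (suc n)) (λ _ → 0)               ≡⟨ ∑-const (allFin (suc n)) 0 ⟩
  length (allFin (suc n)) * 0                ≡⟨ *-zeroʳ (length (allFin (suc n))) ⟩
  0                                          ∎
  where open ≡-Reasoning
#-< {suc n} {suc t} (s≤s t≤n) = begin
  # {suc n} (λ v → toℕ v <? suc t)                             ≡⟨ ∑-allFin {n} (λ v → ind (toℕ v <? suc t)) ⟩
  ind (0 <? suc t) + ∑ (allFin n) (λ v → ind (suc (toℕ v) <? suc t))
    ≡⟨ cong₂ _+_ (ind-yes (0 <? suc t) z<s)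
         (∑-cong (allFin n) λ v → ind-cong (suc (toℕ v) <? suc t) (toℕ v <? t) s<s⁻¹ s<s) ⟩
  suc (# {n} (λ v → toℕ v <? t))                               ≡⟨ cong suc (#-< t≤n) ⟩
  suc t                                                        ∎
  where open ≡-Reasoning

C-monoˡ : {m n : ℕ} (k : ℕ) → m ≤ n → m C k ≤ n C k
C-monoˡ k m≤n = go (≤⇒≤′ m≤n)
  where
  step : ∀ m k → m C k ≤ suc m C k
  step m zero    = ≤-refl
  step m (suc k) = ≤-trans (m≤n+m _ (m C k)) (≤-reflexive (nCk+nC[k+1]≡[n+1]C[k+1] m k))
  go : ∀ {m n} → m ≤′ n → m C k ≤ n C k
  go ≤′-refl         = ≤-refl
  go (≤′-step m≤n) = ≤-trans (go m≤n) (step _ k)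

Within : Pred (Fin n) 0ℓ → Subset n → Set
Within P S = ∀ v → v Subset.∈ S → P v

within? : {P : Pred (Fin n) 0ℓ} → Decidable P → Decidable (Within P)
within? P? S = all? λ v → (v Subset.∈? S) →-dec P? v

module _ {P : Pred (Fin (suc n)) 0ℓ} where

  within-outside : ∀ {S} → Within (P ∘ suc) S → Within P (outside Vec.∷ S)
  within-outside w (suc v) (there v∈) = w v v∈

  within-inside : ∀ {S} → P zero → Within (P ∘ suc) S → Within P (inside Vec.∷ S)
  within-inside p w zero    here       = p
  within-inside p w (suc v) (there v∈) = w v v∈

  within-tail : ∀ {s S} → Within P (s Vec.∷ S) → Within (P ∘ suc) S
  within-tail w v v∈ = w (suc v) (there v∈)

∑-subsets : (f : Subset (suc n) → ℕ) →
            ∑ (subsets (suc n)) f ≡ ∑ (subsets n) (f ∘ (inside Vec.∷_)) + ∑ (subsets n) (f ∘ (outside Vec.∷_))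
∑-subsets {n} f = trans (∑-++ (map (inside Vec.∷_) (subsets n)) _ f)
  (cong₂ _+_ (∑-map (subsets n) _ f) (∑-map (subsets n) _ f))

∑-zero : {A : Set} (xs : List A) {f : A → ℕ} → (∀ x → f x ≡ 0) → ∑ xs f ≡ 0
∑-zero xs f≡0 = trans (∑-cong xs f≡0) (trans (∑-const xs 0) (*-zeroʳ (length xs)))

sized? : {P : Pred (Fin n) 0ℓ} → Decidable P → (r : ℕ) → Decidable (λ S → ∣ S ∣ ≡ r × Within P S)
sized? P? r S = (∣ S ∣ ≟ r) ×-dec within? P? S

-- The sets with and without the vertex `zero` correspond to the two terms of Pascal's rule;
-- `with-zero` is the first term, which vanishes if `zero` violates `P`.
count-within : {P : Pred (Fin n) 0ℓ} (P? : Decidable P) (r : ℕ) →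
               ∑ (subsets n) (ind ∘ sized? P? r) ≡ # P? C r
count-within {zero} P? zero    = refl
count-within {zero} P? (suc r) = refl
count-within {suc n} {P} P? r = begin
  ∑ (subsets (suc n)) (ind ∘ sized? P? r)
    ≡⟨ ∑-subsets (ind ∘ sized? P? r) ⟩
  ∑ (subsets n) (ind ∘ sized? P? r ∘ (inside Vec.∷_)) + ∑ (subsets n) (ind ∘ sized? P? r ∘ (outside Vec.∷_))
    ≡⟨ cong₂ _+_ (insides (P? zero) r) outsides ⟩
  with-zero (P? zero) r + # (P? ∘ suc) C r
    ≡⟨ pascal (P? zero) r ⟩
  (ind (P? zero) + # (P? ∘ suc)) C r
    ≡⟨ cong (_C r) (∑-allFin (ind ∘ P?)) ⟨
  # P? C r
    ∎
  where
  open ≡-Reasoning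
  with-zero : Dec (P zero) → ℕ → ℕ
  with-zero (yes _) zero    = 0
  with-zero (yes _) (suc r) = # (P? ∘ suc) C r
  with-zero (no _)  r       = 0
  pascal : (p? : Dec (P zero)) (r : ℕ) → with-zero p? r + # (P? ∘ suc) C r ≡ (ind p? + # (P? ∘ suc)) C r
  pascal (yes _) zero    = refl
  pascal (yes _) (suc r) = nCk+nC[k+1]≡[n+1]C[k+1] (# (P? ∘ suc)) r
  pascal (no _)  r       = refl
  outsides : ∑ (subsets n) (ind ∘ sized? P? r ∘ (outside Vec.∷_)) ≡ # (P? ∘ suc) C r
  outsides = trans
    (∑-cong (subsets n) λ S → ind-cong (sized? P? r (outside Vec.∷ S)) (sized? (P? ∘ suc) r S)
      (λ (s , w) → s , within-tail w) (λ (s , w) → s , within-outside {P = P} w))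
    (count-within (P? ∘ suc) r)
  insides : (p? : Dec (P zero)) (r : ℕ) →
            ∑ (subsets n) (ind ∘ sized? P? r ∘ (inside Vec.∷_)) ≡ with-zero p? r
  insides (yes p) zero = ∑-zero (subsets n) λ S → ind-no (sized? P? 0 (inside Vec.∷ S)) λ ()
  insides (yes p) (suc r) = trans
    (∑-cong (subsets n) λ S → ind-cong (sized? P? (suc r) (inside Vec.∷ S)) (sized? (P? ∘ suc) r S)
      (λ (s , w) → suc-injective s , within-tail w) (λ (s , w) → cong suc s , within-inside p w))
    (count-within (P? ∘ suc) r)
  insides (no ¬p) r = ∑-zero (subsets n) λ S → ind-no (sized? P? r (inside Vec.∷ S)) λ (_ , w) → ¬p (w zero here)

-- With `P` the neighbourhood of `v`, this holds for every clique through `v`; with `P` the set B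
-- and `v` a new vertex of H, it describes exactly the cliques through `v`.
Link : Pred (Fin n) 0ℓ → Fin n → Subset n → Set
Link P v S = v Subset.∈ S × Within (λ x → x ≡ v ⊎ P x) S

linked? : {P : Pred (Fin n) 0ℓ} → Decidable P → (v : Fin n) (r : ℕ) → Decidable (λ S → ∣ S ∣ ≡ r × Link P v S)
linked? P? v r S = (∣ S ∣ ≟ r) ×-dec (v Subset.∈? S) ×-dec within? (λ x → (x Fin.≟ v) ⊎-dec P? x) S

-- Among the sets inside `P` together with `v`, those that miss `v` are the sets inside `P`. Both
-- kinds are counted by `count-within`, and Pascal's rule gives the difference.
count-linked : {P : Pred (Fin n) 0ℓ} (P? : Decidable P) {v : Fin n} → ¬ P v → (r : ℕ) →
               ∑ (subsets n) (ind ∘ linked? P? v (suc r)) ≡ # P? C r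
count-linked {n} {P} P? {v} ¬pv r = +-cancelʳ-≡ (# P? C suc r) _ _ (begin
  ∑ (subsets n) (ind ∘ linked? P? v (suc r)) + # P? C suc r
    ≡⟨ cong (∑ (subsets n) (ind ∘ linked? P? v (suc r)) +_) (count-within P? (suc r)) ⟨
  ∑ (subsets n) (ind ∘ linked? P? v (suc r)) + ∑ (subsets n) (ind ∘ sized? P? (suc r))
    ≡⟨ ∑-+ (subsets n) _ _ ⟨
  ∑ (subsets n) (λ S → ind (linked? P? v (suc r) S) + ind (sized? P? (suc r) S))
    ≡⟨ ∑-cong (subsets n) split ⟩
  ∑ (subsets n) (ind ∘ sized? Q? (suc r))
    ≡⟨ count-within Q? (suc r) ⟩
  # Q? C suc r
    ≡⟨ cong (_C suc r) #Q ⟩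
  suc (# P?) C suc r
    ≡⟨ nCk+nC[k+1]≡[n+1]C[k+1] (# P?) r ⟨
  # P? C r + # P? C suc r
    ∎)
  where
  open ≡-Reasoning
  Q? : Decidable (λ x → x ≡ v ⊎ P x)
  Q? x = (x Fin.≟ v) ⊎-dec P? x
  ind-⊎ : ∀ x → ind (Q? x) ≡ ind (x Fin.≟ v) + ind (P? x)
  ind-⊎ x with x Fin.≟ v | P? x
  ... | yes refl | yes p = contradiction p ¬pv
  ... | yes refl | no _  = refl
  ... | no _     | yes _ = refl
  ... | no _     | no _  = refl
  #Q : # Q? ≡ suc (# P?)
  #Q = trans (∑-cong (allFin n) ind-⊎) (trans (∑-+ (allFin n) _ _) (cong (_+ # P?) (#-≡ v)))
  split : ∀ S → ind (linked? P? v (suc r) S) + ind (sized? P? (suc r) S) ≡ ind (sized? Q? (suc r) S)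
  split S with v Subset.∈? S
  ... | yes v∈ = trans
    (cong₂ _+_
      (ind-cong ((∣ S ∣ ≟ suc r) ×-dec (yes v∈) ×-dec within? Q? S) (sized? Q? (suc r) S)
        (λ (s , _ , w) → s , w) (λ (s , w) → s , v∈ , w))
      (ind-no (sized? P? (suc r) S) λ (_ , w) → ¬pv (w v v∈)))
    (+-identityʳ _)
  ... | no v∉ = cong₂ _+_ {x = ind ((∣ S ∣ ≟ suc r) ×-dec (no v∉) ×-dec within? Q? S)} {y = 0}
    (ind-no ((∣ S ∣ ≟ suc r) ×-dec (no v∉) ×-dec within? Q? S) λ (_ , v∈ , _) → v∉ v∈)
    (ind-cong (sized? P? (suc r) S) (sized? Q? (suc r) S)
      (λ (s , w) → s , λ x x∈ → inj₂ (w x x∈))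
      (λ (s , w) → s , λ x x∈ → drop-v (w x x∈) x∈))
    where
    drop-v : ∀ {x} → x ≡ v ⊎ P x → x Subset.∈ S → P x
    drop-v (inj₁ refl) x∈ = contradiction x∈ v∉
    drop-v (inj₂ p)    _  = p

-- Cliques and edges

degree-# : (G : Graph n) (v : Fin n) → degree G v ≡ # (adj? G v)
degree-# {n} G v = length-filter (adj? G v) (allFin n)

clique? : (G : Graph n) (r : ℕ) → Decidable (λ S → ∣ S ∣ ≡ r × IsClique G S)
clique? G r S = (∣ S ∣ ≟ r) ×-dec isClique? G S

N-∑ : (G : Graph n) (r : ℕ) → N G r ≡ ∑ (subsets n) (ind ∘ clique? G r)
N-∑ {n} G r = length-filter (clique? G r) (subsets n)

-- A clique either avoids `D` altogether or contains some `v` in `D` and lies within `v` and its at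
-- most `k` neighbours. Cliques with several vertices in `D` are counted repeatedly, which is
-- harmless for an upper bound.
N-upper : (G : Graph n) (D : List (Fin n)) → Unique D → {k : ℕ} → (∀ {v} → v ∈ D → degree G v ≤ k) →
          (r : ℕ) → N G (suc r) ≤ ((n ∸ length D) C suc r) + length D * (k C r)
N-upper {n} G D uniq {k} deg≤ r = begin
  N G (suc r)
    ≡⟨ N-∑ G (suc r) ⟩
  ∑ (subsets n) (ind ∘ clique? G (suc r))
    ≤⟨ ∑-mono (subsets n) (λ {S} _ → pointwise S) ⟩
  ∑ (subsets n) (λ S → ind (sized? ∉D? (suc r) S) + ∑ D (λ v → ind (linked? (adj? G v) v (suc r) S)))
    ≡⟨ ∑-+ (subsets n) _ _ ⟩
  ∑ (subsets n) (ind ∘ sized? ∉D? (suc r)) + ∑ (subsets n) (λ S → ∑ D (λ v → ind (linked? (adj? G v) v (suc r) S)))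
    ≡⟨ cong₂ _+_ (count-within ∉D? (suc r)) (∑-swap (subsets n) D _) ⟩
  (# ∉D? C suc r) + ∑ D (λ v → ∑ (subsets n) (ind ∘ linked? (adj? G v) v (suc r)))
    ≤⟨ +-mono-≤ (C-monoˡ (suc r) #∉D≤) (∑-mono D link≤) ⟩
  ((n ∸ length D) C suc r) + ∑ D (λ _ → k C r)
    ≡⟨ cong (((n ∸ length D) C suc r) +_) (∑-const D (k C r)) ⟩
  ((n ∸ length D) C suc r) + length D * (k C r)
    ∎
  where
  open ≤-Reasoning
  ∈D? : Decidable (_∈ D)
  ∈D? v = any? (v Fin.≟_) D
  ∉D? : Decidable (_∉ D)
  ∉D? = ¬? ∘ ∈D?
  #∈D≥ : length D ≤ # ∈D?
  #∈D≥ = ≤-trans (length-⊆ uniq λ {v} v∈ → ∈-filter⁺ ∈D? (∈-allFin v) v∈)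
                 (≤-reflexive (length-filter ∈D? (allFin n)))
  #∉D≤ : # ∉D? ≤ n ∸ length D
  #∉D≤ = m+n≤o⇒m≤o∸n (# ∉D?) (≤-trans (+-monoʳ-≤ (# ∉D?) #∈D≥)
    (≤-reflexive (trans (+-comm (# ∉D?) (# ∈D?)) (#-¬ ∈D?))))
  link≤ : ∀ {v} → v ∈ D → ∑ (subsets n) (ind ∘ linked? (adj? G v) v (suc r)) ≤ k C r
  link≤ {v} v∈ = ≤-trans (≤-reflexive (count-linked (adj? G v) (Graph.irrefl G refl) r))
    (C-monoˡ r (≤-trans (≤-reflexive (sym (degree-# G v))) (deg≤ v∈)))
  clique⇒link : ∀ {S v} → IsClique G S → v Subset.∈ S → Link (Adj G v) v S
  clique⇒link {S} {v} clique v∈ = v∈ , near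
    where
    near : Within (λ x → x ≡ v ⊎ Adj G v x) S
    near x x∈ with x Fin.≟ v
    ... | yes x≡v = inj₁ x≡v
    ... | no x≢v  = inj₂ (clique v x v∈ x∈ (x≢v ∘ sym))
  pointwise : ∀ S → ind (clique? G (suc r) S) ≤
                    ind (sized? ∉D? (suc r) S) + ∑ D (λ v → ind (linked? (adj? G v) v (suc r) S))
  pointwise S = ind-≤ (clique? G (suc r) S) λ (size , clique) → go size clique (any? (Subset._∈? S) D)
    where
    go : ∣ S ∣ ≡ suc r → IsClique G S → Dec _ →
         1 ≤ ind (sized? ∉D? (suc r) S) + ∑ D (λ v → ind (linked? (adj? G v) v (suc r) S))
    go size clique (no none) = ≤-trans
      (≤-reflexive (sym (ind-yes (sized? ∉D? (suc r) S) (size , λ v v∈S v∈D → none (lose v∈D v∈S)))))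
      (m≤m+n _ _)
    go size clique (yes some) = let v , v∈D , v∈S = find some in ≤-trans
      (≤-reflexive (sym (ind-yes (linked? (adj? G v) v (suc r) S) (size , clique⇒link clique v∈S))))
      (≤-trans (∑-∈ v∈D) (m≤n+m _ _))

-- Edges as two-element cliques

edgePairs : Graph n → List (Fin n × Fin n)
edgePairs {n} G = filter (λ (u , v) → (u Fin.<? v) ×-dec adj? G u v) (cartesianProduct (allFin n) (allFin n))

edgePairs-unique : (G : Graph n) → Unique (edgePairs G)
edgePairs-unique {n} G = Unique.filter⁺ _ (Unique.cartesianProduct⁺ (Unique.allFin⁺ n) (Unique.allFin⁺ n))

∈-edgePairs⁺ : (G : Graph n) {u v : Fin n} → u Fin.< v → Adj G u v → (u , v) ∈ edgePairs G
∈-edgePairs⁺ {n} G {u} {v} u<v uv =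
  ∈-filter⁺ _ (∈-cartesianProduct⁺ (∈-allFin u) (∈-allFin v)) (u<v , uv)

∈-edgePairs⁻ : (G : Graph n) {u v : Fin n} → (u , v) ∈ edgePairs G → u Fin.< v × Adj G u v
∈-edgePairs⁻ {n} G e∈ = proj₂ (∈-filter⁻ _ {xs = cartesianProduct (allFin n) (allFin n)} e∈)

∈-subsets : (S : Subset n) → S ∈ subsets n
∈-subsets Vec.[]            = here refl
∈-subsets (true  Vec.∷ S) = ∈-++⁺ˡ (∈-map⁺ _ (∈-subsets S))
∈-subsets (false Vec.∷ S) = ∈-++⁺ʳ (map (inside Vec.∷_) (subsets _)) (∈-map⁺ _ (∈-subsets S))

pair : Fin n → Fin n → Subset n
pair u v = ⁅ u ⁆ Subset.∪ ⁅ v ⁆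

∣pair∣ : {u v : Fin n} → u ≢ v → ∣ pair u v ∣ ≡ 2
∣pair∣ {suc n} {zero}  {zero}  u≢v = contradiction refl u≢v
∣pair∣ {suc n} {zero}  {suc v} u≢v = cong suc (trans (cong ∣_∣ (Subset.∪-identityˡ ⁅ v ⁆)) (Subset.∣⁅x⁆∣≡1 v))
∣pair∣ {suc n} {suc u} {zero}  u≢v = cong suc (trans (cong ∣_∣ (Subset.∪-identityʳ ⁅ u ⁆)) (Subset.∣⁅x⁆∣≡1 u))
∣pair∣ {suc n} {suc u} {suc v} u≢v = ∣pair∣ (u≢v ∘ cong suc)

∈-pair⁻ : {u v x : Fin n} → x Subset.∈ pair u v → x ≡ u ⊎ x ≡ v
∈-pair⁻ {u = u} {v} x∈ with Subset.x∈p∪q⁻ ⁅ u ⁆ ⁅ v ⁆ x∈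
... | inj₁ p = inj₁ (Subset.x∈⁅y⁆⇒x≡y u p)
... | inj₂ p = inj₂ (Subset.x∈⁅y⁆⇒x≡y v p)

∈-pairˡ : (u v : Fin n) → u Subset.∈ pair u v
∈-pairˡ u v = Subset.x∈p∪q⁺ (inj₁ (Subset.x∈⁅x⁆ u))

∈-pairʳ : (u v : Fin n) → v Subset.∈ pair u v
∈-pairʳ u v = Subset.x∈p∪q⁺ {p = ⁅ u ⁆} (inj₂ (Subset.x∈⁅x⁆ v))

pair-injective : {u v u′ v′ : Fin n} → u Fin.< v → u′ Fin.< v′ → pair u v ≡ pair u′ v′ → (u , v) ≡ (u′ , v′)
pair-injective {u = u} {v} {u′} {v′} u<v u′<v′ eq
  with ∈-pair⁻ (subst (u Subset.∈_) eq (∈-pairˡ u v)) | ∈-pair⁻ (subst (v Subset.∈_) eq (∈-pairʳ u v))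
     | ∈-pair⁻ (subst (u′ Subset.∈_) (sym eq) (∈-pairˡ u′ v′))
... | inj₁ refl | inj₁ refl | _         = contradiction refl (Fin.<⇒≢ u<v)
... | inj₁ refl | inj₂ refl | _         = refl
... | inj₂ refl | inj₁ refl | _         = contradiction u<v (Fin.<-asym u′<v′)
... | inj₂ refl | inj₂ refl | _         = contradiction refl (Fin.<⇒≢ u<v)

unique-map : {A B : Set} (f : A → B) {xs : List A} → Unique xs →
             (∀ {x y} → x ∈ xs → y ∈ xs → f x ≡ f y → x ≡ y) → Unique (map f xs)
unique-map f {[]}     []          inj = []
unique-map f {x ∷ xs} (x≢ ∷ uniq) inj =
  All.map⁺ (All.tabulate λ y∈ fx≡fy → All.lookup x≢ y∈ (inj (here refl) (there y∈) fx≡fy))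
  ∷ unique-map f uniq λ x∈ y∈ → inj (there x∈) (there y∈)

-- Transfers the clique bound for r = 2 to the number of edges, since `pair` maps the edges
-- injectively to cliques.
∣E∣≤N₂ : (G : Graph n) → ∣E G ∣ ≤ N G 2
∣E∣≤N₂ {n} G = subst (_≤ N G 2) (length-map (λ (u , v) → pair u v) (edgePairs G)) (length-⊆
  (unique-map _ (edgePairs-unique G) λ x∈ y∈ →
    pair-injective (proj₁ (∈-edgePairs⁻ G x∈)) (proj₁ (∈-edgePairs⁻ G y∈)))
  isEdge)
  where
  isEdge : map (λ (u , v) → pair u v) (edgePairs G) ⊆ filter (clique? G 2) (subsets n)
  isEdge S∈ with ∈-map⁻ _ S∈
  ... | (u , v) , uv∈ , refl =
    let u<v , uv = ∈-edgePairs⁻ G uv∈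
        clique : IsClique G (pair u v)
        clique x y x∈ y∈ x≢y = case ∈-pair⁻ x∈ , ∈-pair⁻ y∈ of λ where
          (inj₁ refl , inj₁ refl) → contradiction refl x≢y
          (inj₁ refl , inj₂ refl) → uv
          (inj₂ refl , inj₁ refl) → Graph.sym G uv
          (inj₂ refl , inj₂ refl) → contradiction refl x≢y
    in ∈-filter⁺ (clique? G 2) (∈-subsets (pair u v)) (∣pair∣ (Fin.<⇒≢ u<v) , clique)

-- Convexity of hᵣ in d

-- Nonnegative second differences, stated without truncated subtraction.
Convex : (ℕ → ℕ) → Set
Convex f = ∀ k → f (1 + k) + f (1 + k) ≤ f k + f (2 + k)

-- If the first difference is nonnegative, so are all later ones, and the right end dominates.
-- Otherwise `f 0` exceeds `f 1`, and the claim for the shifted function suffices.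
convex-≤-max₀ : (f : ℕ → ℕ) → Convex f → ∀ {k t} → k ≤ t → f k ≤ f 0 ⊔ f t
convex-≤-max₀ f convex z≤n = m≤m⊔n _ _
convex-≤-max₀ f convex {suc k} {suc t} (s≤s k≤t) with f 0 ≤? f 1
... | yes f0≤f1 = ≤-trans (increasing (≤⇒≤′ (s≤s k≤t))) (m≤n⊔m (f 0) _)
  where
  step : ∀ k → f k ≤ f (suc k)
  step zero    = f0≤f1
  step (suc k) = +-cancelˡ-≤ (f (suc k)) _ _ (≤-trans (convex k) (+-monoˡ-≤ (f (2 + k)) (step k)))
  increasing : ∀ {j k} → j ≤′ k → f j ≤ f k
  increasing ≤′-refl       = ≤-refl
  increasing (≤′-step j≤k) = ≤-trans (increasing j≤k) (step _)
... | no f0≰f1 = ≤-trans (convex-≤-max₀ (f ∘ suc) (convex ∘ suc) k≤t) (⊔-monoˡ-≤ (f (suc t)) (≰⇒≥ f0≰f1))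

convex-≤-max : (f : ℕ → ℕ) → Convex f → ∀ {i k t} → i ≤ k → k ≤ t → f k ≤ f i ⊔ f t
convex-≤-max f convex z≤n       k≤t       = convex-≤-max₀ f convex k≤t
convex-≤-max f convex (s≤s i≤k) (s≤s k≤t) = convex-≤-max (f ∘ suc) (convex ∘ suc) i≤k k≤t

m∸[n∸o]≡m∸n+o : {m n o : ℕ} → n ≤ m → o ≤ n → m ∸ (n ∸ o) ≡ m ∸ n + o
m∸[n∸o]≡m∸n+o {m} {n} {o} n≤m o≤n = begin
  m ∸ (n ∸ o)                     ≡⟨ cong (_∸ (n ∸ o)) (m∸n+n≡m n≤m) ⟨
  m ∸ n + n ∸ (n ∸ o)             ≡⟨ +-∸-assoc (m ∸ n) (m∸n≤m n o) ⟩
  m ∸ n + (n ∸ (n ∸ o))           ≡⟨ cong (m ∸ n +_) (m∸[m∸n]≡n o≤n) ⟩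
  m ∸ n + o                       ∎
  where open ≡-Reasoning

convex-+ : {f g : ℕ → ℕ} → Convex f → Convex g → Convex (λ k → f k + g k)
convex-+ {f} {g} cf cg k = subst₂ _≤_ (regroup (f (1 + k)) _ (g (1 + k)) _) (regroup (f k) _ (g k) _) (+-mono-≤ (cf k) (cg k))
  where
  regroup : ∀ a b c d → a + b + (c + d) ≡ a + c + (b + d)
  regroup = solve-∀

-- By Pascal's rule the differences of a binomial coefficient in its upper index are binomial
-- coefficients of one order less, which grow with that index.
convex-C : (c r : ℕ) → Convex (λ k → (c + k) C r)
convex-C c r k rewrite +-suc c (1 + k) | +-suc c k = go r (c + k)
  where
  go : ∀ r m → (1 + m) C r + (1 + m) C r ≤ m C r + (2 + m) C r
  go zero    m = ≤-refl
  go (suc r) m = begin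
    (1 + m) C suc r + (1 + m) C suc r           ≡⟨ cong (_+ (1 + m) C suc r) (nCk+nC[k+1]≡[n+1]C[k+1] m r) ⟨
    m C r + m C suc r + (1 + m) C suc r         ≤⟨ +-monoˡ-≤ ((1 + m) C suc r) (+-monoˡ-≤ (m C suc r) (C-monoˡ r (n≤1+n m))) ⟩
    (1 + m) C r + m C suc r + (1 + m) C suc r   ≡⟨ shuffle ((1 + m) C r) (m C suc r) ((1 + m) C suc r) ⟩
    m C suc r + ((1 + m) C r + (1 + m) C suc r) ≡⟨ cong (m C suc r +_) (nCk+nC[k+1]≡[n+1]C[k+1] (1 + m) r) ⟩
    m C suc r + (2 + m) C suc r                 ∎
    where
    open ≤-Reasoning
    shuffle : ∀ a b c → a + b + c ≡ b + (a + c)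
    shuffle = solve-∀

-- Before truncation sets in this is `convex-C` read backwards, as `Convex` is symmetric in its
-- outer terms. At the kink the middle value is `0 C r`, which vanishes for positive `r`.
convex-∸C : (c r : ℕ) → 2 ≤ r → Convex (λ k → (c ∸ k) C r)
convex-∸C zero    r 2≤r zero    = ≤-refl
convex-∸C zero    r 2≤r (suc k) = ≤-refl
convex-∸C (suc c) r 2≤r (suc k) = convex-∸C c r 2≤r k
convex-∸C (suc zero) r 2≤r zero rewrite k>n⇒nCk≡0 {0} {r} (≤-trans (s≤s z≤n) 2≤r) = z≤n
convex-∸C (suc (suc c)) r 2≤r zero =
  ≤-trans (≤-trans (≤-reflexive (cong (λ m → m C r + m C r) (sym (trans (+-suc c 0) (cong suc (+-identityʳ c))))))
     (convex-C c r 0))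
   (≤-reflexive (trans (+-comm ((c + 0) C r) _) (cong₂ (λ a b → a C r + b C r) (+-comm c 2) (+-identityʳ c))))

-- A product of nonnegative, nondecreasing convex functions is convex: convexity of the second
-- factor handles the multiple by `k`, its monotonicity the remaining terms.
convex-*C : (c r : ℕ) → Convex (λ k → k * ((c + k) C r))
convex-*C c r k = begin
  (1 + k) * x₁ + (1 + k) * x₁     ≡⟨ double k x₁ ⟩
  k * (x₁ + x₁) + (x₁ + x₁)       ≤⟨ +-mono-≤ (*-monoʳ-≤ k (convex-C c r k)) (+-mono-≤ x₁≤x₂ x₁≤x₂) ⟩
  k * (x₀ + x₂) + (x₂ + x₂)       ≡⟨ collect k x₀ x₂ ⟩
  k * x₀ + (2 + k) * x₂           ∎
  where
  open ≤-Reasoning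
  x₀ = (c + k) C r
  x₁ = (c + (1 + k)) C r
  x₂ = (c + (2 + k)) C r
  x₁≤x₂ : x₁ ≤ x₂
  x₁≤x₂ = C-monoˡ r (+-monoʳ-≤ c (n≤1+n (1 + k)))
  double : ∀ k a → (1 + k) * a + (1 + k) * a ≡ k * (a + a) + (a + a)
  double = solve-∀
  collect : ∀ k a b → k * (a + b) + (b + b) ≡ k * a + (2 + k) * b
  collect = solve-∀

hᵣ-≤-max : (r n ℓ : ℕ) {d k m : ℕ} → 2 ≤ r → ℓ ≤ d → d ≤ k → k ≤ m → m ≤ n →
           hᵣ r n k ℓ ≤ hᵣ r n d ℓ ⊔ hᵣ r n m ℓ
hᵣ-≤-max r n ℓ {d} {k} {m} 2≤r ℓ≤d d≤k k≤m m≤n =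
  subst₂ _≤_ (value ℓ≤k (≤-trans k≤m m≤n))
    (cong₂ _⊔_ (value ℓ≤d (≤-trans d≤k (≤-trans k≤m m≤n))) (value (≤-trans ℓ≤k k≤m) m≤n))
    (convex-≤-max f f-convex (∸-monoˡ-≤ ℓ d≤k) (∸-monoˡ-≤ ℓ k≤m))
  where
  -- The substitution `j = k ∸ ℓ` turns n - k + ℓ into n - j and k into ℓ + j, so both factors of
  -- the second summand increase with `j`.
  f : ℕ → ℕ
  f j = (n ∸ j) C r + j * ((ℓ + j) C (r ∸ 1))
  f-convex : Convex f
  f-convex = convex-+ {λ j → (n ∸ j) C r} (convex-∸C n r 2≤r) (convex-*C ℓ (r ∸ 1))
  ℓ≤k : ℓ ≤ k
  ℓ≤k = ≤-trans ℓ≤d d≤k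
  value : ∀ {k} → ℓ ≤ k → k ≤ n → f (k ∸ ℓ) ≡ hᵣ r n k ℓ
  value {k} ℓ≤k k≤n = cong₂ (λ a b → a C r + (k ∸ ℓ) * (b C (r ∸ 1))) (m∸[n∸o]≡m∸n+o k≤n ℓ≤k) (m+[n∸m]≡n ℓ≤k)

-- Paths and their arcs

-- Unlike in `Linked`, both ends are part of the type, so that walks can be joined, reversed and
-- split while keeping track of where they end.
data Path (R : Rel A 0ℓ) : A → A → List A → Set where
  [-] : Path R x x [ x ]
  _∷_ : ∀ {x y z ys} → R x y → Path R y z ys → Path R x z (x ∷ ys)

path-last∈ : Path R x y xs → y ∈ xs
path-last∈ [-]     = here refl
path-last∈ (_ ∷ p) = there (path-last∈ p)

path-map : (∀ {a b} → Step a b xs → R a b → S a b) → Path R x y xs → Path S x y xs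
path-map f [-]             = [-]
path-map f (r ∷ [-])       = f here r ∷ [-]
path-map f (r ∷ p@(_ ∷ _)) = f here r ∷ path-map (f ∘ there) p

path-++ : Path R x y xs → R y u → Path R u v ys → Path R x v (xs ++ ys)
path-++ [-]      s q = s ∷ q
path-++ (r ∷ p)  s q = r ∷ path-++ p s q

path-reverse : Symmetric R → Path R x y xs → Path R y x (reverse xs)
path-reverse R-sym [-] = [-]
path-reverse {xs = x ∷ xs} R-sym (r ∷ p) =
  subst (Path _ _ _) (sym (unfold-reverse x xs)) (path-++ (path-reverse R-sym p) (R-sym r) [-])

step-++ˡ : Step u v xs → Step u v (xs ++ ys)
step-++ˡ here      = here
step-++ˡ (there p) = there (step-++ˡ p)

step-++ʳ : (xs : List A) → Step u v ys → Step u v (xs ++ ys)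
step-++ʳ []       p = p
step-++ʳ (x ∷ xs) p = there (step-++ʳ xs p)

step-join : Path R x y xs → Path R u v ys → Step y u (xs ++ ys)
step-join [-]     [-]     = here
step-join [-]     (_ ∷ _) = here
step-join (_ ∷ p) q       = there (step-join p q)

step-reverse : Step u v xs → Step v u (reverse xs)
step-reverse {u = u} {v} {_ ∷ _ ∷ xs} here = subst (Step v u)
  (sym (trans (unfold-reverse u (v ∷ xs)) (trans (cong (_∷ʳ u) (unfold-reverse v xs)) (++-assoc (reverse xs) [ v ] [ u ]))))
  (step-++ʳ (reverse xs) here)
step-reverse {xs = x ∷ xs} (there p) = subst (Step _ _) (sym (unfold-reverse x xs)) (step-++ˡ (step-reverse p))

step-++⁻ : ∀ {a b} → Path R x y xs → Path R u v ys → Step a b (xs ++ ys) →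
           Step a b xs ⊎ Step a b ys ⊎ (a ≡ y × b ≡ u)
step-++⁻ [-]             [-]     here      = inj₂ (inj₂ (refl , refl))
step-++⁻ [-]             (_ ∷ _) here      = inj₂ (inj₂ (refl , refl))
step-++⁻ [-]             q       (there s) = inj₂ (inj₁ s)
step-++⁻ (_ ∷ [-])       q       here      = inj₁ here
step-++⁻ (_ ∷ (_ ∷ _))   q       here      = inj₁ here
step-++⁻ (_ ∷ p)         q       (there s) = Sum.map₁ there (step-++⁻ p q s)

step-∈ˡ : Step u v xs → u ∈ xs
step-∈ˡ here      = here refl
step-∈ˡ (there s) = there (step-∈ˡ s)

step-∈-tail : Step u v (x ∷ xs) → v ∈ xs
step-∈-tail here              = here refl
step-∈-tail (there s@here)      = there (step-∈-tail s)
step-∈-tail (there s@(there _)) = there (step-∈-tail s)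

step-∈ʳ : Step u v xs → v ∈ xs
step-∈ʳ here      = there (here refl)
step-∈ʳ (there s) = there (step-∈ʳ s)

step-≢ : Unique xs → Step u v xs → u ≢ v
step-≢ (x≢ ∷ _)    here      = All.lookup x≢ (here refl)
step-≢ (_ ∷ uniq) (there s) = step-≢ uniq s

path-split : ∀ {a b} → Path R x y xs → Step a b xs →
             ∃[ as ] ∃[ bs ] xs ≡ as ++ bs × Path R x a as × Path R b y bs
path-split (_ ∷ [-])       here      = _ , _ , refl , [-] , [-]
path-split (_ ∷ p@(_ ∷ _)) here      = _ , _ , refl , [-] , p
path-split (r ∷ p)         (there s) with path-split p s
... | as , bs , refl , p₁ , p₂ = _ , _ , refl , r ∷ p₁ , p₂

linked⇒path : ∀ {x} xs → Linked R (x ∷ xs ∷ʳ s) → ∃[ t ] Path R x t (x ∷ xs) × R t s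
linked⇒path []       (r ∷ [-]) = _ , [-] , r
linked⇒path (y ∷ xs) (r ∷ rs) with linked⇒path xs rs
... | t , p , c = t , r ∷ p , c

path⇒linked : Path R x t xs → R t s → Linked R (xs ∷ʳ s)
path⇒linked [-]             c = c ∷ [-]
path⇒linked (r ∷ [-])       c = r ∷ c ∷ [-]
path⇒linked (r ∷ p@(_ ∷ _)) c = r ∷ path⇒linked p c

linked⇒step : Linked R xs → Step u v xs → R u v
linked⇒step (r ∷ _)  here      = r
linked⇒step (_ ∷ rs) (there s) = linked⇒step rs s

-- If the arc lies inside the list, the two pieces are swapped and joined by the closing arc from
-- `t` to `s`; if it is the closing arc itself, the list stays as it is. Only the arc from `a` to
-- `b` is lost.
open-cycle : ∀ {a b} → Path R s t xs → R t s → Step a b (xs ∷ʳ s) →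
             ∃[ ys ] ys ↭ xs × Path R b a ys ×
               (∀ {x y} → Step x y (xs ∷ʳ s) → Step x y ys ⊎ (x ≡ a × y ≡ b))
open-cycle {xs = xs} p c a→b with step-++⁻ p [-] a→b
... | inj₂ (inj₂ (refl , refl)) = xs , ↭-refl , p , λ st → case step-++⁻ p [-] st of λ where
  (inj₁ st′)              → inj₁ st′
  (inj₂ (inj₁ (there ())))
  (inj₂ (inj₂ eqs))       → inj₂ eqs
... | inj₂ (inj₁ (there ()))
... | inj₁ a→b′ with path-split p a→b′
...   | as , bs , refl , p₁ , p₂ = bs ++ as , ++-comm bs as , path-++ p₂ c p₁ , λ st → case step-++⁻ p [-] st of λ where
  (inj₂ (inj₁ (there ())))
  (inj₂ (inj₂ (refl , refl))) → inj₁ (step-join p₂ p₁)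
  (inj₁ st′) → case step-++⁻ p₁ p₂ st′ of λ where
    (inj₁ st″)        → inj₁ (step-++ʳ bs st″)
    (inj₂ (inj₁ st″)) → inj₁ (step-++ˡ st″)
    (inj₂ (inj₂ eqs)) → inj₂ eqs

-- Arcs as a list, for counting

arcs : List A → List (A × A)
arcs []           = []
arcs (x ∷ [])     = []
arcs (x ∷ y ∷ ys) = (x , y) ∷ arcs (y ∷ ys)

∈-arcs⁻ : {u v : A} (xs : List A) → (u , v) ∈ arcs xs → Step u v xs
∈-arcs⁻ (x ∷ y ∷ ys) (here refl) = here
∈-arcs⁻ (x ∷ y ∷ ys) (there e)   = there (∈-arcs⁻ (y ∷ ys) e)

∈-arcs⁺ : {u v : A} {xs : List A} → Step u v xs → (u , v) ∈ arcs xs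
∈-arcs⁺ here                = here refl
∈-arcs⁺ (there s@here)      = there (∈-arcs⁺ s)
∈-arcs⁺ (there s@(there _)) = there (∈-arcs⁺ s)

∑-arcs-source : Path R x y xs → (f : A → ℕ) → ∑ xs f ≡ ∑ (arcs xs) (f ∘ proj₁) + f y
∑-arcs-source [-] f = +-comm (f _) 0
∑-arcs-source {x = x} (_ ∷ p@[-])     f = trans (cong (f x +_) (∑-arcs-source p f)) (sym (+-assoc (f x) _ _))
∑-arcs-source {x = x} (_ ∷ p@(_ ∷ _)) f = trans (cong (f x +_) (∑-arcs-source p f)) (sym (+-assoc (f x) _ _))

∑-arcs-target : (xs : List A) (f : A → ℕ) → ∑ (x ∷ xs) f ≡ f x + ∑ (arcs (x ∷ xs)) (f ∘ proj₂)
∑-arcs-target []       f = refl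
∑-arcs-target {x = x} (y ∷ xs) f = cong (f x +_) (∑-arcs-target xs f)

length-arcs : ∀ x (xs : List A) → length (arcs (x ∷ xs)) ≡ length xs
length-arcs x []       = refl
length-arcs x (y ∷ xs) = cong suc (length-arcs y xs)

-- Edges are counted as pairs with the smaller end first, whereas a walk may traverse them in either
-- direction.
normalise : Fin n × Fin n → Fin n × Fin n
normalise (u , v) with u Fin.<? v
... | yes _ = u , v
... | no _  = v , u

normalise-cases : ∀ (u v : Fin n) → u ≢ v →
  (u Fin.< v × normalise (u , v) ≡ (u , v)) ⊎ (v Fin.< u × normalise (u , v) ≡ (v , u))
normalise-cases u v u≢v with u Fin.<? v
... | yes u<v = inj₁ (u<v , refl)
... | no u≮v  = inj₂ (Fin.≤∧≢⇒< (≮⇒≥ u≮v) (u≢v ∘ sym) , refl)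

normalise-sources : ∀ (u v x y : Fin n) → normalise (u , v) ≡ normalise (x , y) → u ≡ x ⊎ u ≡ y
normalise-sources u v x y eq with u Fin.<? v | x Fin.<? y
normalise-sources u v x y refl | yes _ | yes _ = inj₁ refl
normalise-sources u v x y refl | yes _ | no _  = inj₂ refl
normalise-sources u v x y refl | no _  | yes _ = inj₂ refl
normalise-sources u v x y refl | no _  | no _  = inj₁ refl

-- Another arc on the same edge as the first would contain the first vertex, which does not occur
-- again.
arcs-unique : {xs : List (Fin n)} → Unique xs → Unique (map normalise (arcs xs))
arcs-unique {xs = []}         _                 = []
arcs-unique {xs = x ∷ []}     _                 = []
arcs-unique {xs = x ∷ y ∷ ys} (x≢ ∷ uniq) =
  All.map⁺ (All.tabulate λ { {u , v} uv∈ eq →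
    case normalise-sources x y u v eq of λ where
      (inj₁ refl) → All.lookup x≢ (step-∈ˡ (∈-arcs⁻ (y ∷ ys) uv∈)) refl
      (inj₂ refl) → All.lookup x≢ (step-∈ʳ (∈-arcs⁻ (y ∷ ys) uv∈)) refl })
  ∷ arcs-unique uniq

-- Limits the crossings that would break an edge of `F`: the arcs of a walk without repetitions are
-- distinct edges.
arcs-≤-edges : (F : Graph n) {xs : List (Fin n)} → Unique xs →
               ∑ (arcs xs) (λ (u , v) → ind (adj? F u v)) ≤ ∣E F ∣
arcs-≤-edges {n} F {xs} uniq = begin
  ∑ (arcs xs) (ind ∘ F?)                           ≤⟨ ∑-mono (arcs xs) (λ {(u , v)} _ →
                                                          ind-mono (adj? F u v) (F? (normalise (u , v))) (F-normalise u v)) ⟩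
  ∑ (arcs xs) (ind ∘ F? ∘ normalise)               ≡⟨ ∑-map (arcs xs) normalise (ind ∘ F?) ⟨
  ∑ (map normalise (arcs xs)) (ind ∘ F?)           ≡⟨ length-filter F? (map normalise (arcs xs)) ⟨
  length (filter F? (map normalise (arcs xs)))     ≤⟨ length-⊆ (Unique.filter⁺ F? (arcs-unique uniq)) isEdge ⟩
  ∣E F ∣                                           ∎
  where
  open ≤-Reasoning
  F? : Decidable (λ ((u , v) : Fin n × Fin n) → Adj F u v)
  F? (u , v) = adj? F u v
  F-normalise : ∀ u v → Adj F u v → let (x , y) = normalise (u , v) in Adj F x y
  F-normalise u v uv with u Fin.<? v
  ... | yes _ = uv
  ... | no _  = Graph.sym F uv
  isEdge : filter F? (map normalise (arcs xs)) ⊆ edgePairs F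
  isEdge e∈ with ∈-filter⁻ F? {xs = map normalise (arcs xs)} e∈
  ... | e∈′ , fe with ∈-map⁻ normalise e∈′
  ... | (u , v) , uv∈ , refl with normalise-cases u v (step-≢ uniq (∈-arcs⁻ xs uv∈))
  ... | inj₁ (u<v , eq) rewrite eq = ∈-edgePairs⁺ F u<v fe
  ... | inj₂ (v<u , eq) rewrite eq = ∈-edgePairs⁺ F v<u fe

-- Every edge selects an arc that traverses it. Repeated vertices do no harm, so this applies to
-- closed walks, where the start occurs twice.
edges-≤-arcs : (F : Graph n) {xs : List (Fin n)} → (∀ u v → Adj F u v → Traverses u v xs) →
               ∣E F ∣ ≤ ∑ (arcs xs) (λ (u , v) → ind (adj? F u v))
edges-≤-arcs {n} F {xs} traversed = begin
  ∣E F ∣                                           ≤⟨ length-⊆ (edgePairs-unique F) isArc ⟩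
  length (map normalise (filter F? (arcs xs)))     ≡⟨ length-map normalise (filter F? (arcs xs)) ⟩
  length (filter F? (arcs xs))                     ≡⟨ length-filter F? (arcs xs) ⟩
  ∑ (arcs xs) (ind ∘ F?)                           ∎
  where
  open ≤-Reasoning
  F? : Decidable (λ ((u , v) : Fin n × Fin n) → Adj F u v)
  F? (u , v) = adj? F u v
  normalise-< : ∀ {u v : Fin n} → u Fin.< v → (u , v) ≡ normalise (u , v) × (u , v) ≡ normalise (v , u)
  normalise-< {u} {v} u<v with u Fin.<? v | v Fin.<? u
  ... | yes _  | yes v<u = contradiction v<u (Fin.<-asym u<v)
  ... | yes _  | no _    = refl , refl
  ... | no u≮v | _       = contradiction u<v u≮v
  isArc : edgePairs F ⊆ map normalise (filter F? (arcs xs))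
  isArc {u , v} e∈ with ∈-edgePairs⁻ F e∈
  ... | u<v , uv with traversed u v uv
  ... | inj₁ u→v = subst (_∈ _) (sym (proj₁ (normalise-< u<v)))
    (∈-map⁺ normalise (∈-filter⁺ F? (∈-arcs⁺ u→v) uv))
  ... | inj₂ v→u = subst (_∈ _) (sym (proj₂ (normalise-< u<v)))
    (∈-map⁺ normalise (∈-filter⁺ F? (∈-arcs⁺ v→u) (Graph.sym F uv)))

unique-resp-↭ : xs ↭ ys → Unique xs → Unique ys
unique-resp-↭ perm = Permutation.Unique-resp-↭ (setoid _) (↭⇒↭ₛ perm)

linked-map : (∀ {x y} → Step x y xs → R x y → S x y) → Linked R xs → Linked S xs
linked-map f []       = []
linked-map f [-]      = [-]
linked-map f (r ∷ rs) = f here r ∷ linked-map (f ∘ there) rs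

-- Closure

HamThrough : Graph n → Graph n → Set
HamThrough G F = Σ[ c ∈ HamiltonianCycle G ] (∀ u v → Adj F u v → Traverses u v (closedWalk c))

path⇒ham : (G F : Graph n) {s t : Fin n} {xs : List (Fin n)} → 3 ≤ n →
           Path (Adj G) s t xs → Adj G t s → Unique xs → (∀ v → v ∈ xs) →
           (∀ u v → Adj F u v → Traverses u v (xs ∷ʳ s)) → HamThrough G F
path⇒ham G F {xs = x ∷ xs} 3≤n p c uniq cover traversed = ham p (path⇒linked p c) traversed
  where
  ham : ∀ {s t} → Path (Adj G) s t (x ∷ xs) → Linked (Adj G) ((x ∷ xs) ∷ʳ s) →
        (∀ u v → Adj F u v → Traverses u v ((x ∷ xs) ∷ʳ s)) → HamThrough G F
  -- Both clauses build the same cycle; matching on the path identifies its start `s` with the head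
  -- `x` of the list.
  ham [-]     l tr = record { atLeast3 = 3≤n ; distinct = uniq ; spanning = cover ; adjacent = l } , tr
  ham (_ ∷ _) l tr = record { atLeast3 = 3≤n ; distinct = uniq ; spanning = cover ; adjacent = l } , tr

-- Ore's crossing argument: with a and b consecutive on the path v … a b … u,
-- v … a u … b v is a cycle if v is adjacent to b and u to a.
reroute : (G F : Graph n) {u v : Fin n} {xs : List (Fin n)} → 3 ≤ n →
          n + ∣E F ∣ ≤ degree G u + degree G v →
          Path (Adj G) v u xs → Unique xs → (∀ v → v ∈ xs) →
          (∀ x y → Adj F x y → Traverses x y xs) → HamThrough G F
reroute {n} G F {u} {v} {xs} 3≤n large p uniq cover traversed
  with any? (λ (a , b) → adj? G u a ×-dec adj? G v b ×-dec ¬? (adj? F a b)) (arcs xs)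
-- The degree of `u` counts arcs by their source and that of `v` by their target; neither end is its
-- own neighbour, so leaving out the last or first vertex costs nothing. An arc counted twice must
-- lie in `F`, so the degree sum is less than n + ∣E F∣.
... | no none = contradiction large (<⇒≱ (begin
  suc (degree G u + degree G v)
    ≡⟨ cong suc (cong₂ _+_ (degree-sum u) (degree-sum v)) ⟩
  suc (∑ xs (ind ∘ adj? G u) + ∑ xs (ind ∘ adj? G v))
    ≡⟨ cong suc (cong₂ _+_ sources (targets p)) ⟩
  suc (∑ (arcs xs) (λ (a , b) → ind (adj? G u a)) + ∑ (arcs xs) (λ (a , b) → ind (adj? G v b)))
    ≡⟨ cong suc (∑-+ (arcs xs) _ _) ⟨
  suc (∑ (arcs xs) (λ (a , b) → ind (adj? G u a) + ind (adj? G v b)))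
    ≤⟨ s≤s (∑-mono (arcs xs) λ {(a , b)} e∈ → pointwise a b e∈) ⟩
  suc (∑ (arcs xs) (λ (a , b) → 1 + ind (adj? F a b)))
    ≡⟨ cong suc (∑-+ (arcs xs) _ _) ⟩
  suc (∑ (arcs xs) (λ _ → 1) + ∑ (arcs xs) (λ (a , b) → ind (adj? F a b)))
    ≤⟨ s≤s (+-monoʳ-≤ (∑ (arcs xs) (λ _ → 1)) (arcs-≤-edges F uniq)) ⟩
  suc (∑ (arcs xs) (λ _ → 1)) + ∣E F ∣
    ≡⟨ cong (_+ ∣E F ∣) (trans (cong suc (sym (length-∑ (arcs xs)))) (length-path p)) ⟩
  length xs + ∣E F ∣
    ≤⟨ +-monoˡ-≤ ∣E F ∣ (≤-trans (length-⊆ uniq (λ {x} _ → ∈-allFin x)) (≤-reflexive (length-tabulate id))) ⟩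
  n + ∣E F ∣
    ∎))
  where
  open ≤-Reasoning
  length-path : ∀ {x y xs} → Path (Adj G) x y xs → suc (length (arcs xs)) ≡ length xs
  length-path {xs = x ∷ xs} _ = cong suc (length-arcs x xs)
  degree-sum : ∀ w → degree G w ≡ ∑ xs (ind ∘ adj? G w)
  degree-sum w = trans (degree-# G w)
    (∑-≈ (Unique.allFin⁺ n) uniq (λ {x} _ → cover x) (λ {x} _ → ∈-allFin x))
  loop : ∀ w → ind (adj? G w w) ≡ 0
  loop w = ind-no (adj? G w w) (Graph.irrefl G refl)
  sources : ∑ xs (ind ∘ adj? G u) ≡ ∑ (arcs xs) (λ (a , b) → ind (adj? G u a))
  sources = trans (∑-arcs-source p (ind ∘ adj? G u)) (trans (cong (∑ (arcs xs) (ind ∘ adj? G u ∘ proj₁) +_) (loop u)) (+-identityʳ _))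
  targets : ∀ {v u xs} → Path (Adj G) v u xs → ∑ xs (ind ∘ adj? G v) ≡ ∑ (arcs xs) (λ (a , b) → ind (adj? G v b))
  targets {v} {xs = _ ∷ xs} [-]     = trans (∑-arcs-target xs (ind ∘ adj? G v))
    (cong (_+ ∑ (arcs (v ∷ [])) (ind ∘ adj? G v ∘ proj₂)) (loop v))
  targets {v} {xs = _ ∷ xs} (_ ∷ _) = trans (∑-arcs-target xs (ind ∘ adj? G v))
    (cong (_+ ∑ (arcs (v ∷ xs)) (ind ∘ adj? G v ∘ proj₂)) (loop v))
  pointwise : ∀ a b → (a , b) ∈ arcs xs → ind (adj? G u a) + ind (adj? G v b) ≤ 1 + ind (adj? F a b)
  pointwise a b e∈ = go (adj? G u a) (adj? G v b) (adj? F a b) (λ ua vb ¬fab → none (lose e∈ (ua , vb , ¬fab)))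
    where
    go : ∀ {P Q R : Set} (p? : Dec P) (q? : Dec Q) (r? : Dec R) → (P → Q → ¬ ¬ R) → ind p? + ind q? ≤ 1 + ind r?
    go (yes p) (yes q) (yes r) f = ≤-refl
    go (yes p) (yes q) (no ¬r) f = contradiction ¬r (f p q)
    go (yes p) (no _)  r?      f = s≤s z≤n
    go (no _)  q?      r?      f = ≤-trans (ind≤1 q?) (s≤s z≤n)
... | yes found with find found
... | (a , b) , ab∈ , ua , vb , ¬fab with path-split p (∈-arcs⁻ xs ab∈)
... | as , bs , refl , p₁ , p₂ = path⇒ham G F 3≤n cycle ua
    (unique-resp-↭ (↭-sym perm) uniq) (λ w → ∈-resp-↭ (↭-sym perm) (cover w))
    (λ x y xy → [ moved xy , Sum.swap ∘ moved (Graph.sym F xy) ]′ (traversed x y xy))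
  where
  zs = reverse as ++ bs
  perm : zs ↭ as ++ bs
  perm = ++⁺ʳ bs (↭-reverse as)
  cycle : Path (Adj G) a u zs
  cycle = path-++ (path-reverse (Graph.sym G) p₁) vb p₂
  -- Arcs in the first piece are reversed, those in the second kept; the only arc lost is the one
  -- from `a` to `b`, chosen outside `F`.
  moved : ∀ {x y} → Adj F x y → Step x y (as ++ bs) → Traverses x y (zs ∷ʳ a)
  moved xy st with step-++⁻ p₁ p₂ st
  ... | inj₁ st′                 = inj₂ (step-++ˡ (step-++ˡ (step-reverse st′)))
  ... | inj₂ (inj₁ st′)          = inj₁ (step-++ˡ (step-++ʳ (reverse as) st′))
  ... | inj₂ (inj₂ (refl , refl)) = contradiction xy ¬fab

addEdge : (G : Graph n) (u v : Fin n) → u ≢ v → Graph n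
addEdge G u v u≢v = record
  { Adj    = λ x y → Adj G x y ⊎ (x ≡ u × y ≡ v) ⊎ (x ≡ v × y ≡ u)
  ; adj?   = λ x y → adj? G x y ⊎-dec ((x Fin.≟ u) ×-dec (y Fin.≟ v)) ⊎-dec ((x Fin.≟ v) ×-dec (y Fin.≟ u))
  ; sym    = λ { (inj₁ xy)               → inj₁ (Graph.sym G xy)
               ; (inj₂ (inj₁ (p , q)))   → inj₂ (inj₂ (q , p))
               ; (inj₂ (inj₂ (p , q)))   → inj₂ (inj₁ (q , p)) }
  ; irrefl = λ { refl (inj₁ xx)                  → Graph.irrefl G refl xx
               ; refl (inj₂ (inj₁ (refl , eq)))  → u≢v eq
               ; refl (inj₂ (inj₂ (refl , eq)))  → u≢v (sym eq) }
  }

-- No step enters the first vertex b, and a step from b to the last vertex a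
-- would leave no room for a third vertex.
ends-not-step : {a b : A} → 3 ≤ length xs → Unique xs → Path R b a xs →
                ¬ Step a b xs × ¬ Step b a xs
ends-not-step {R = R} 3≤ uniq p = not-into-first uniq p , not-first-last 3≤ uniq p
  where
  not-into-first : ∀ {a b c xs} → Unique xs → Path R b c xs → ¬ Step a b xs
  not-into-first (b≢ ∷ _) (_ ∷ _) st = All.lookup b≢ (step-∈-tail st) refl
  not-into-first _        [-]     (there ())
  not-first-last : ∀ {a b xs} → 3 ≤ length xs → Unique xs → Path R b a xs → ¬ Step b a xs
  not-first-last 3≤ (b≢ ∷ (a≢ ∷ _)) (_ ∷ (_ ∷ p)) here       = All.lookup a≢ (path-last∈ p) refl
  not-first-last (s≤s (s≤s ())) uniq (_ ∷ [-]) st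
  not-first-last 3≤ (b≢ ∷ _)        (_ ∷ p)       (there st) = All.lookup b≢ (step-∈ˡ st) refl

-- A cycle that avoids the added edge already lies in `G`. Otherwise it is opened at that edge, in
-- whichever direction it is traversed, and the resulting path is rerouted. No edge of `F` is lost
-- in opening, because `F` lies in `G` and `uv` does not.
closure : (G F : Graph n) {u v : Fin n} (u≢v : u ≢ v) → ¬ Adj G u v → F ⊆ᴳ G →
          n + ∣E F ∣ ≤ degree G u + degree G v → HamThrough (addEdge G u v u≢v) F → HamThrough G F
closure {n} G F {u} {v} u≢v ¬uv F⊆G large (c , traversed) =
  [ [ open-at u v (inj₁ (refl , refl)) large
    , open-at v u (inj₂ (refl , refl)) (subst (n + ∣E F ∣ ≤_) (+-comm (degree G u) _) large) ]′
  , unused ]′ used?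
  where
  open HamiltonianCycle c using (start; rest; atLeast3; distinct; spanning; adjacent)
  W = closedWalk c
  Added : Rel (Fin n) 0ℓ
  Added x y = (x ≡ u × y ≡ v) ⊎ (x ≡ v × y ≡ u)
  step? : ∀ x y → Dec (Step x y W)
  step? x y = map′ (∈-arcs⁻ W) ∈-arcs⁺ (any? (≡-dec Fin._≟_ Fin._≟_ (x , y)) (arcs W))
  used? : (Step u v W ⊎ Step v u W) ⊎ ¬ (Step u v W ⊎ Step v u W)
  used? = toSum (step? u v ⊎-dec step? v u)
  walk = linked⇒path rest adjacent
  unused : ¬ (Step u v W ⊎ Step v u W) → HamThrough G F
  unused ¬used = record
    { atLeast3 = atLeast3 ; distinct = distinct ; spanning = spanning
    ; adjacent = linked-map (λ st → [ id , (λ where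
        (inj₁ (refl , refl)) → contradiction (inj₁ st) ¬used
        (inj₂ (refl , refl)) → contradiction (inj₂ st) ¬used) ]′) adjacent } , traversed
  F-new : ∀ {x y} → Adj F x y → ¬ Added x y
  F-new xy (inj₁ (refl , refl)) = ¬uv (F⊆G xy)
  F-new xy (inj₂ (refl , refl)) = ¬uv (Graph.sym G (F⊆G xy))
  open-at : ∀ a b → Added a b → n + ∣E F ∣ ≤ degree G a + degree G b → Step a b W → HamThrough G F
  open-at a b new large a→b with walk
  ... | t , p , t→s with open-cycle p t→s a→b
  ... | ys , perm , q , kept = reroute G F atLeast3 large q′ uniq (λ w → ∈-resp-↭ (↭-sym perm) (spanning w))
    λ x y xy → [ inj₁ ∘ keep xy , inj₂ ∘ keep (Graph.sym F xy) ]′ (traversed x y xy)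
    where
    uniq : Unique ys
    uniq = unique-resp-↭ (↭-sym perm) distinct
    long : 3 ≤ length ys
    long = ≤-trans atLeast3 (≤-trans (≤-reflexive (sym (length-tabulate {n = n} id)))
      (length-⊆ (Unique.allFin⁺ n) λ {w} _ → ∈-resp-↭ (↭-sym perm) (spanning w)))
    -- The opened path is a path of `G` only if it does not use the added edge again, in either
    -- direction; here the presence of a third vertex matters.
    ¬new : ∀ {x y} → Added a b → Step x y ys → ¬ Added x y
    ¬new (inj₁ (refl , refl)) st (inj₁ (refl , refl)) = proj₁ (ends-not-step long uniq q) st
    ¬new (inj₁ (refl , refl)) st (inj₂ (refl , refl)) = proj₂ (ends-not-step long uniq q) st
    ¬new (inj₂ (refl , refl)) st (inj₁ (refl , refl)) = proj₂ (ends-not-step long uniq q) st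
    ¬new (inj₂ (refl , refl)) st (inj₂ (refl , refl)) = proj₁ (ends-not-step long uniq q) st
    q′ : Path (Adj G) b a ys
    q′ = path-map (λ st → [ id , (λ new′ → contradiction new′ (¬new new st)) ]′) q
    keep : ∀ {x y} → Adj F x y → Step x y W → Step x y ys
    keep xy st with kept st
    ... | inj₁ st′           = st′
    ... | inj₂ (refl , refl) = contradiction new (F-new xy)

-- Saturated graphs

unique-path : (G : Graph n) → (∀ u v → u ≢ v → Adj G u v) → {x : Fin n} {xs : List (Fin n)} →
              Unique (x ∷ xs) → ∃[ t ] Path (Adj G) x t (x ∷ xs)
unique-path G complete {x} {[]}     _           = x , [-]
unique-path G complete {x} {y ∷ ys} (x≢ ∷ uniq) with unique-path G complete uniq
... | t , p = t , complete x y (All.lookup x≢ (here refl)) ∷ p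

traverses-concat : {u v : A} {xss : List (List A)} → Any (Traverses u v) xss → Traverses u v (concat xss)
traverses-concat (here tr) = Sum.map step-++ˡ step-++ˡ tr
traverses-concat {xss = xs ∷ _} (there trs) = Sum.map (step-++ʳ xs) (step-++ʳ xs) (traverses-concat trs)

-- The paths of the forest, strung together, list every vertex once; in a complete graph the gaps
-- between consecutive paths, and the gap at the end, are edges.
complete-ham : (G F : Graph n) → 3 ≤ n → (∀ u v → u ≢ v → Adj G u v) → IsLinearForest F → HamThrough G F
complete-ham {n} G F 3≤n complete forest = go refl disjoint covering
  where
  open IsLinearForest forest
  go : ∀ {xs} → concat paths ≡ xs → Unique xs → (∀ v → v ∈ xs) → HamThrough G F
  go {xs} eq uniq cover with ≤-trans 3≤n (≤-trans (≤-reflexive (sym (length-tabulate {n = n} id)))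
                                         (length-⊆ (Unique.allFin⁺ n) λ {w} _ → cover w))
  go {x ∷ y ∷ zs} eq uniq@(x≢ ∷ uniq′) cover | _ with unique-path G complete uniq′
  ... | t , p = path⇒ham G F 3≤n (complete x y (All.lookup x≢ (here refl)) ∷ p)
    (complete t x (λ t≡x → All.lookup x≢ (path-last∈ p) (sym t≡x))) uniq cover
    λ u v uv → Sum.map step-++ˡ step-++ˡ
      (subst (Traverses u v) eq (traverses-concat (Equivalence.to (edges u v) uv)))
  go {x ∷ []} eq uniq cover | s≤s ()

NonEdge : Graph n → Fin n × Fin n → Set
NonEdge G (u , v) = u ≢ v × ¬ Adj G u v

nonEdge? : (G : Graph n) → Decidable (NonEdge G)
nonEdge? G (u , v) = ¬? (u Fin.≟ v) ×-dec ¬? (adj? G u v)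

nonEdges : Graph n → List (Fin n × Fin n)
nonEdges {n} G = filter (nonEdge? G) (cartesianProduct (allFin n) (allFin n))

∈-nonEdges⁺ : (G : Graph n) {u v : Fin n} → NonEdge G (u , v) → (u , v) ∈ nonEdges G
∈-nonEdges⁺ G {u} {v} = ∈-filter⁺ (nonEdge? G) (∈-cartesianProduct⁺ (∈-allFin u) (∈-allFin v))

∈-nonEdges⁻ : (G : Graph n) {e : Fin n × Fin n} → e ∈ nonEdges G → NonEdge G e
∈-nonEdges⁻ {n} G e∈ = proj₂ (∈-filter⁻ (nonEdge? G) {xs = cartesianProduct (allFin n) (allFin n)} e∈)

nonEdges-unique : (G : Graph n) → Unique (nonEdges G)
nonEdges-unique {n} G = Unique.filter⁺ (nonEdge? G) (Unique.cartesianProduct⁺ (Unique.allFin⁺ n) (Unique.allFin⁺ n))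

-- The measure that makes the repeated addition of edges terminate.
nonEdges-addEdge : (G : Graph n) {u v : Fin n} (u≢v : u ≢ v) → ¬ Adj G u v →
                   length (nonEdges (addEdge G u v u≢v)) < length (nonEdges G)
nonEdges-addEdge G {u} {v} u≢v ¬uv = length-⊆ (All.tabulate new ∷ nonEdges-unique G⁺) λ where
    (here refl) → ∈-nonEdges⁺ G (u≢v , ¬uv)
    (there e∈)  → let x≢y , ¬xy = ∈-nonEdges⁻ G⁺ e∈ in ∈-nonEdges⁺ G (x≢y , ¬xy ∘ inj₁)
  where
  G⁺ = addEdge G u v u≢v
  new : ∀ {e} → e ∈ nonEdges G⁺ → (u , v) ≢ e
  new e∈ refl = proj₂ (∈-nonEdges⁻ G⁺ e∈) (inj₂ (inj₁ (refl , refl)))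

degree-mono : {G G⁺ : Graph n} → G ⊆ᴳ G⁺ → ∀ v → degree G v ≤ degree G⁺ v
degree-mono {n} {G} {G⁺} G⊆ v = length-filter-mono (adj? G v) (adj? G⁺ v) (allFin n) G⊆

N-mono : {G G⁺ : Graph n} → G ⊆ᴳ G⁺ → ∀ r → N G r ≤ N G⁺ r
N-mono {n} {G} {G⁺} G⊆ r = length-filter-mono (clique? G r) (clique? G⁺ r) (subsets n)
  λ (size , clique) → size , λ u v u∈ v∈ u≢v → G⊆ (clique u v u∈ v∈ u≢v)

degree<n : (G : Graph n) (v : Fin n) → degree G v < n
degree<n {n} G v = subst (degree G v <_) (length-tabulate id)
  (filter-notAll (adj? G v) (allFin n) (lose (∈-allFin v) (Graph.irrefl G refl)))

∈-take : ∀ m → x ∈ take m xs → x ∈ xs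
∈-take {xs = _ ∷ _} (suc m) (here refl) = here refl
∈-take {xs = _ ∷ _} (suc m) (there x∈)  = there (∈-take m x∈)

-- The non-neighbours of v number at least k − ℓ, where k = deg u, and by
-- maximality have degree at most k; the cliques avoiding k − ℓ of them lie
-- within n − k + ℓ vertices.
N-saturated : (G : Graph n) {u v : Fin n} {ℓ : ℕ} → ℓ ≤ degree G u → degree G u + degree G v < n + ℓ →
              (∀ {x y} → NonEdge G (x , y) → degree G x + degree G y ≤ degree G u + degree G v) →
              (r : ℕ) → N G (suc r) ≤ hᵣ (suc r) n (degree G u) ℓ
N-saturated {n} G {u} {v} {ℓ} ℓ≤k small maximal r = begin
  N G (suc r)
    ≤⟨ N-upper G D (Unique.take⁺ (k ∸ ℓ) (Unique.filter⁺ far? (Unique.allFin⁺ n))) low r ⟩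
  ((n ∸ length D) C suc r) + length D * (k C r)
    ≡⟨ cong (λ t → ((n ∸ t) C suc r) + t * (k C r)) |D| ⟩
  ((n ∸ (k ∸ ℓ)) C suc r) + (k ∸ ℓ) * (k C r)
    ≡⟨ cong (λ t → (t C suc r) + (k ∸ ℓ) * (k C r)) (m∸[n∸o]≡m∸n+o (<⇒≤ (degree<n G u)) ℓ≤k) ⟩
  hᵣ (suc r) n k ℓ
    ∎
  where
  open ≤-Reasoning
  k = degree G u
  far? : Decidable (λ w → NonEdge G (w , v))
  far? w = nonEdge? G (w , v)
  far = filter far? (allFin n)
  -- Exactly k - ℓ of the non-neighbours are kept, so that the bound of `N-upper` takes the form of
  -- `hᵣ`.
  D = take (k ∸ ℓ) far
  low : ∀ {w} → w ∈ D → degree G w ≤ k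
  low {w} w∈ = +-cancelʳ-≤ (degree G v) _ _
    (maximal (proj₂ (∈-filter⁻ far? {xs = allFin n} (∈-take (k ∸ ℓ) w∈))))
  pointwise : ∀ w → 1 ≤ ind (far? w) + (ind (adj? G v w) + ind (w Fin.≟ v))
  pointwise w with w Fin.≟ v
  ... | yes _  = ≤-trans (m≤n+m 1 (ind (adj? G v w))) (m≤n+m _ 0)
  ... | no w≢v with adj? G w v | adj? G v w
  ...   | yes wv | yes vw = s≤s z≤n
  ...   | yes wv | no ¬vw = contradiction (Graph.sym G wv) ¬vw
  ...   | no ¬wv | _      = s≤s z≤n
  n≤ : n ≤ length far + (degree G v + 1)
  n≤ = begin
    n
      ≡⟨ trans (sym (length-tabulate id)) (length-∑ (allFin n)) ⟩
    ∑ (allFin n) (λ _ → 1)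
      ≤⟨ ∑-mono (allFin n) (λ {w} _ → pointwise w) ⟩
    ∑ (allFin n) (λ w → ind (far? w) + (ind (adj? G v w) + ind (w Fin.≟ v)))
      ≡⟨ trans (∑-+ (allFin n) _ _) (cong (# far? +_) (∑-+ (allFin n) _ _)) ⟩
    # far? + (# (adj? G v) + # (Fin._≟ v))
      ≡⟨ cong₂ _+_ (length-filter far? (allFin n)) (cong₂ _+_ (degree-# G v) (sym (#-≡ v))) ⟨
    length far + (degree G v + 1)
      ∎
  -- Apart from `v` and its neighbours all vertices are in `far`, so it has at least n - 1 - deg v
  -- members, and the degree sum is at most n + ℓ - 1.
  k≤ : k ≤ length far + ℓ
  k≤ = +-cancelʳ-≤ (degree G v + 1) _ _ (begin
    k + (degree G v + 1)                    ≡⟨ rearrange₁ k (degree G v) ⟩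
    suc (k + degree G v)                    ≤⟨ small ⟩
    n + ℓ                                   ≤⟨ +-monoˡ-≤ ℓ n≤ ⟩
    length far + (degree G v + 1) + ℓ       ≡⟨ rearrange₂ (length far) (degree G v + 1) ℓ ⟩
    length far + ℓ + (degree G v + 1)       ∎)
    where
    rearrange₁ : ∀ a b → a + (b + 1) ≡ suc (a + b)
    rearrange₁ = solve-∀
    rearrange₂ : ∀ a b c → a + b + c ≡ a + c + b
    rearrange₂ = solve-∀
  |D| : length D ≡ k ∸ ℓ
  |D| = trans (length-take (k ∸ ℓ) far) (m≤n⇒m⊓n≡m (m≤n+o⇒m∸n≤o k ℓ (≤-trans k≤ (≤-reflexive (+-comm (length far) ℓ)))))

half : {m k : ℕ} → k + k ≤ m → k ≤ ⌊ m /2⌋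
half {m} {k} k+k≤m = subst (_≤ ⌊ m /2⌋) (sym (n≡⌊n+n/2⌋ k)) (⌊n/2⌋-mono k+k≤m)

double : {m k : ℕ} → k ≤ ⌊ m /2⌋ → k + k ≤ m
double {m} k≤ = ≤-trans (+-mono-≤ k≤ (≤-trans k≤ (⌊n/2⌋≤⌈n/2⌉ m))) (≤-reflexive (⌊n/2⌋+⌈n/2⌉≡n m))

-- The upper bound on the number of cliques

module _ {n d ℓ : ℕ} (ℓ<d : ℓ < d) (2d<n+ℓ : d + d < n + ℓ) where

  -- From 2(ℓ + 1) ≤ 2d < n + ℓ. It supplies the three vertices that a cycle must have.
  ℓ+3≤n : ℓ + 3 ≤ n
  ℓ+3≤n = +-cancelʳ-≤ ℓ _ _ (begin
    ℓ + 3 + ℓ          ≡⟨ rearrange ℓ ⟩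
    suc (suc ℓ + suc ℓ) ≤⟨ s≤s (+-mono-≤ ℓ<d ℓ<d) ⟩
    suc (d + d)        ≤⟨ 2d<n+ℓ ⟩
    n + ℓ              ∎)
    where
    open ≤-Reasoning
    rearrange : ∀ a → a + 3 + a ≡ suc (suc a + suc a)
    rearrange = solve-∀

  3≤n : 3 ≤ n
  3≤n = ≤-trans (m≤n+m 3 ℓ) ℓ+3≤n

  d<n : d < n
  d<n = +-cancelʳ-≤ ℓ _ _ (≤-trans (s≤s (+-monoʳ-≤ d (<⇒≤ ℓ<d))) 2d<n+ℓ)

module _ {n d ℓ : ℕ} (ℓ<d : ℓ < d) (2d<n+ℓ : d + d < n + ℓ) (r : ℕ) (1≤r : 1 ≤ r) where

  d⁺ : ℕ
  d⁺ = ⌊ n + ℓ ∸ 1 /2⌋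

  bound : ℕ
  bound = hᵣ (suc r) n d ℓ ⊔ hᵣ (suc r) n d⁺ ℓ

  d⁺≤n : d⁺ ≤ n
  d⁺≤n = ≤-trans (⌊n/2⌋-mono (≤-trans (m∸n≤m (n + ℓ) 1) (+-monoʳ-≤ n (≤-trans (m≤m+n ℓ 3) (ℓ+3≤n ℓ<d 2d<n+ℓ)))))
                (≤-reflexive (sym (n≡⌊n+n/2⌋ n)))

  -- With deg u the smaller degree, 2 deg u ≤ n + ℓ - 1, so deg u lies between `d` and `d⁺`, where
  -- convexity bounds `hᵣ` by its values at the ends.
  saturated-≤-bound : (G : Graph n) → (∀ v → d ≤ degree G v) → {u v : Fin n} →
                      degree G u ≤ degree G v → degree G u + degree G v < n + ℓ →
                      (∀ {x y} → NonEdge G (x , y) → degree G x + degree G y ≤ degree G u + degree G v) →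
                      N G (suc r) ≤ bound
  saturated-≤-bound G d≤δ {u} {v} du≤dv small maximal = ≤-trans
    (N-saturated G (≤-trans (<⇒≤ ℓ<d) (d≤δ u)) small maximal r)
    (hᵣ-≤-max (suc r) n ℓ (s≤s 1≤r) (<⇒≤ ℓ<d) (d≤δ u)
      (half (≤-trans (+-monoʳ-≤ (degree G u) du≤dv) (m+n≤o⇒m≤o∸n _ (≤-trans (≤-reflexive (+-comm _ 1)) small)))) d⁺≤n)

  module _ (F : Graph n) (forest : IsLinearForest F) (∣F∣≡ℓ : ∣E F ∣ ≡ ℓ) where

    -- The fuel exceeds the number of non-edges. The hypotheses on `G` are those that persist when
    -- an edge is added, so the induction can continue with the larger graph.
    dense⇒ham : (fuel : ℕ) (G : Graph n) → length (nonEdges G) < fuel → F ⊆ᴳ G →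
                (∀ v → d ≤ degree G v) → bound < N G (suc r) → HamThrough G F
    dense⇒ham (suc fuel) G (s≤s enough) F⊆G d≤δ dense = go (nonEdges G) refl
      where
      go : ∀ es → nonEdges G ≡ es → HamThrough G F
      go [] eq = complete-ham G F (3≤n ℓ<d 2d<n+ℓ)
        (λ u v u≢v → decidable-stable (adj? G u v) λ ¬uv →
          case subst (_ ∈_) eq (∈-nonEdges⁺ G (u≢v , ¬uv)) of λ ())
        forest
      go (e ∷ es) eq = largest top (∈-nonEdges⁻ G (subst (top ∈_) (sym eq) top∈))
          λ {e′} xy → All.lookup totals (subst (e′ ∈_) eq (∈-nonEdges⁺ G xy))
        where
        total : Fin n × Fin n → ℕ
        total (u , v) = degree G u + degree G v
        -- The head `e` serves as the default of `argmax`, so the result is a genuine non-edge. Its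
        -- maximality is what makes all non-neighbours of an end have small degree if its sum is
        -- below n + ℓ.
        top = argmax total e es
        top∈ : top ∈ e ∷ es
        top∈ = argmax-all total {P = _∈ (e ∷ es)} (here refl) (All.tabulate there)
        totals : All (λ e′ → total e′ ≤ total top) (e ∷ es)
        totals = f[⊥]≤f[argmax] {f = total} e es ∷ f[xs]≤f[argmax] {f = total} e es
        largest : (e : Fin n × Fin n) → NonEdge G e → (∀ {e′} → NonEdge G e′ → total e′ ≤ total e) → HamThrough G F
        largest (u , v) (u≢v , ¬uv) maximal with n + ℓ ≤? degree G u + degree G v
        ... | yes large = closure G F u≢v ¬uv F⊆G (subst (λ t → n + t ≤ _) (sym ∣F∣≡ℓ) large)
          (dense⇒ham fuel G⁺ (≤-trans (nonEdges-addEdge G u≢v ¬uv) enough) (inj₁ ∘ F⊆G)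
            (λ w → ≤-trans (d≤δ w) (degree-mono {G = G} {G⁺} inj₁ w))
            (≤-trans dense (N-mono {G = G} {G⁺} inj₁ (suc r))))
          where G⁺ = addEdge G u v u≢v
        ... | no small = contradiction dense (≤⇒≯ ([ below , below′ ]′ (≤-total (degree G u) (degree G v))))
          where
          below : degree G u ≤ degree G v → N G (suc r) ≤ bound
          below du≤dv = saturated-≤-bound G d≤δ du≤dv (≰⇒> small) maximal
          swapped : degree G u + degree G v ≡ degree G v + degree G u
          swapped = +-comm (degree G u) (degree G v)
          below′ : degree G v ≤ degree G u → N G (suc r) ≤ bound
          below′ dv≤du = saturated-≤-bound G d≤δ dv≤du (subst (_< n + ℓ) swapped (≰⇒> small))
            λ {x} {y} xy → subst (total (x , y) ≤_) swapped (maximal xy)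

  N-≤-bound : (G : Graph n) → d ≤ δ G → ¬ Hamiltonian ℓ G → N G (suc r) ≤ bound
  N-≤-bound G d≤δ ¬ham = ≮⇒≥ λ dense → ¬ham λ F forest ∣F∣≡ℓ F⊆G →
    -- The argument `≤-refl` fixes the fuel at one more than the number of non-edges.
    dense⇒ham F forest ∣F∣≡ℓ _ G ≤-refl F⊆G
      (λ v → ≤-trans d≤δ (All.lookup (min≤xs n (map (degree G) (allFin n))) (∈-map⁺ (degree G) (∈-allFin v))))
      dense

-- The graphs H

module PathForest {n : ℕ} {ps : List (Fin n)} (uniq : Unique ps) where

  traverses? : ∀ u v → Dec (Traverses u v ps)
  traverses? u v = step? u v ⊎-dec step? v u
    where
    step? : ∀ u v → Dec (Step u v ps)
    step? u v = map′ (∈-arcs⁻ ps) ∈-arcs⁺ (any? (≡-dec Fin._≟_ Fin._≟_ (u , v)) (arcs ps))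

  pathGraph : Graph n
  pathGraph = record
    { Adj    = λ u v → Traverses u v ps
    ; adj?   = traverses?
    ; sym    = Sum.swap
    ; irrefl = λ { refl → [ no-loop , no-loop ]′ }
    }
    where
    no-loop : ∀ {u} → ¬ Step u u ps
    no-loop st = step-≢ uniq st refl

  isForest : IsLinearForest pathGraph
  isForest = record
    { paths    = ps ∷ map [_] others
    ; disjoint = subst (λ qs → Unique (ps ++ qs)) (sym concat-map-[ others ])
                   (Unique.++⁺ uniq (Unique.filter⁺ ∉ps? (Unique.allFin⁺ n))
                     λ (v∈ps , v∈) → proj₂ (∈-filter⁻ ∉ps? {xs = allFin n} v∈) v∈ps)
    ; covering = λ v → subst (λ qs → v ∈ ps ++ qs) (sym concat-map-[ others ]) (cover v (∈ps? v))
    ; edges    = λ u v → mk⇔ here λ { (here tr) → tr ; (there tr) → contradiction tr (singles others) }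
    }
    where
    ∈ps? : Decidable (_∈ ps)
    ∈ps? v = any? (v Fin.≟_) ps
    ∉ps? : Decidable (_∉ ps)
    ∉ps? = ¬? ∘ ∈ps?
    others : List (Fin n)
    others = filter ∉ps? (allFin n)
    cover : ∀ v → Dec (v ∈ ps) → v ∈ ps ++ others
    cover v (yes v∈) = ∈-++⁺ˡ v∈
    cover v (no v∉)  = ∈-++⁺ʳ ps (∈-filter⁺ ∉ps? (∈-allFin v) v∉)
    singles : ∀ {u v} qs → ¬ Any (Traverses u v) (map [_] qs)
    singles (_ ∷ qs) (here (inj₁ (there ())))
    singles (_ ∷ qs) (here (inj₂ (there ())))
    singles (_ ∷ qs) (there tr) = singles qs tr

  ∣E∣≡arcs : ∣E pathGraph ∣ ≡ length (arcs ps)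
  ∣E∣≡arcs = ≤-antisym
    (≤-trans (edges-≤-arcs pathGraph {ps} λ _ _ → id)
      (≤-trans (∑-mono (arcs ps) λ {(u , v)} _ → ind≤1 (traverses? u v)) (≤-reflexive (sym (length-∑ (arcs ps))))))
    (≤-trans (≤-reflexive (length-∑ (arcs ps)))
      (≤-trans (∑-mono (arcs ps) λ {(u , v)} e∈ →
          ≤-reflexive (sym (ind-yes (traverses? u v) (inj₁ (∈-arcs⁻ ps e∈)))))
        (arcs-≤-edges pathGraph uniq)))

-- Sums and invariants along a closed walk

∑-closed-source : (xs : List A) (s : A) (f : A → ℕ) → ∑ (arcs (xs ∷ʳ s)) (f ∘ proj₁) ≡ ∑ xs f
∑-closed-source []           s f = refl
∑-closed-source (x ∷ [])     s f = refl
∑-closed-source (x ∷ y ∷ xs) s f = cong (f x +_) (∑-closed-source (y ∷ xs) s f)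

∑-closed-target : (x : A) (xs : List A) (f : A → ℕ) → ∑ (arcs (x ∷ xs ∷ʳ x)) (f ∘ proj₂) ≡ ∑ (x ∷ xs) f
∑-closed-target x xs f = +-cancelˡ-≡ (f x) _ _ (begin
  f x + ∑ (arcs (x ∷ xs ∷ʳ x)) (f ∘ proj₂)  ≡⟨ ∑-arcs-target (xs ∷ʳ x) f ⟨
  ∑ (x ∷ xs ∷ʳ x) f                         ≡⟨ ∑-++ (x ∷ xs) [ x ] f ⟩
  ∑ (x ∷ xs) f + (f x + 0)                  ≡⟨ trans (cong (∑ (x ∷ xs) f +_) (+-identityʳ (f x))) (+-comm _ (f x)) ⟩
  f x + ∑ (x ∷ xs) f                        ∎)
  where open ≡-Reasoning

module _ {Q : A → Set} where

  -- Followed forward from `a`, the property reaches the end of the walk. On a closed walk that is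
  -- the start again, from where `closed-all` carries it all the way round.
  closed-last : ∀ xs {s a} → (∀ {x y} → Step x y (xs ∷ʳ s) → Q x → Q y) → a ∈ xs → Q a → Q s
  closed-last (x ∷ [])     closed (here refl) q = closed here q
  closed-last (x ∷ y ∷ xs) closed (here refl) q = closed-last (y ∷ xs) (closed ∘ there) (here refl) (closed here q)
  closed-last (x ∷ xs)     closed (there a∈)  q = closed-last xs (closed ∘ there) a∈ q

  closed-all : ∀ {s} xs → (∀ {x y} → Step x y (s ∷ xs) → Q x → Q y) → Q s → All Q (s ∷ xs)
  closed-all []       closed q = q ∷ []
  closed-all (x ∷ xs) closed q = q ∷ closed-all xs (closed ∘ there) (closed here q)

module Extremal {n d ℓ : ℕ} (ℓ<d : ℓ < d) (2d<n+ℓ : d + d < n + ℓ) where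

  private
    a : ℕ
    a = n ∸ d + ℓ
    G = H n d ℓ

  d≤n : d ≤ n
  d≤n = <⇒≤ (d<n ℓ<d 2d<n+ℓ)

  -- Rewrites 2d < n + ℓ as d < n - d + ℓ. So B is a proper part of A, and the vertex numbered `d`
  -- lies in A but not in B.
  d<a : d < a
  d<a = +-cancelʳ-≤ d _ _ (begin
    suc d + d           ≤⟨ 2d<n+ℓ ⟩
    n + ℓ               ≡⟨ cong (_+ ℓ) (m∸n+n≡m d≤n) ⟨
    n ∸ d + d + ℓ       ≡⟨ swap (n ∸ d) d ℓ ⟩
    n ∸ d + ℓ + d       ∎)
    where
    open ≤-Reasoning
    swap : ∀ a b c → a + b + c ≡ a + c + b
    swap = solve-∀

  a≡ : n ∸ (d ∸ ℓ) ≡ a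
  a≡ = m∸[n∸o]≡m∸n+o d≤n (<⇒≤ ℓ<d)

  a≤n : a ≤ n
  a≤n = subst (_≤ n) a≡ (m∸n≤m n (d ∸ ℓ))

  inA? : Decidable (InA n d ℓ)
  inA? v = toℕ v <? a

  inB? : Decidable (InB n d ℓ)
  inB? v = toℕ v <? d

  new? : Decidable (New n d ℓ)
  new? = ¬? ∘ inA?

  B⇒A : ∀ {v} → InB n d ℓ v → InA n d ℓ v
  B⇒A v<d = <-trans v<d d<a

  #new : # new? ≡ d ∸ ℓ
  #new = begin
    # new?                     ≡⟨ m+n∸m≡n (# inA?) (# new?) ⟨
    # inA? + # new? ∸ # inA?   ≡⟨ cong₂ _∸_ (#-¬ inA?) (#-< a≤n) ⟩
    n ∸ a                      ≡⟨ cong (n ∸_) a≡ ⟨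
    n ∸ (n ∸ (d ∸ ℓ))          ≡⟨ m∸[m∸n]≡n (≤-trans (m∸n≤m d ℓ) d≤n) ⟩
    d ∸ ℓ                      ∎
    where open ≡-Reasoning

  new-adj⇒B : ∀ {u v} → New n d ℓ u → Adj G u v → InB n d ℓ v
  new-adj⇒B new (_ , inj₁ (inA , _))        = contradiction inA new
  new-adj⇒B new (_ , inj₂ (inj₁ (inB , _))) = contradiction (B⇒A inB) new
  new-adj⇒B new (_ , inj₂ (inj₂ (_ , inB))) = inB

  A-adj : ∀ {u v} → u ≢ v → InA n d ℓ u → InA n d ℓ v → Adj G u v
  A-adj u≢v inA inA′ = u≢v , inj₁ (inA , inA′)

  new-adj : ∀ {u v} → New n d ℓ u → InB n d ℓ v → Adj G u v
  new-adj new inB = (λ { refl → new (B⇒A inB) }) , inj₂ (inj₂ (new , inB))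

  degree-new : ∀ {v} → New n d ℓ v → degree G v ≡ d
  degree-new {v} new = trans (degree-# G v) (trans
    (∑-cong (allFin n) λ w → ind-cong (adj? G v w) (inB? w) (new-adj⇒B new) (new-adj new))
    (#-< d≤n))

  d≤degree : ∀ v → d ≤ degree G v
  d≤degree v = [ d≤degree-A , ≤-reflexive ∘ sym ∘ degree-new ]′ (toSum (inA? v))
    where
    open ≤-Reasoning
    pointwise : InA n d ℓ v → ∀ w → ind (inA? w) ≤ ind (w Fin.≟ v) + ind (adj? G v w)
    pointwise inA w = go (w Fin.≟ v)
      where
      go : (w≟v : Dec (w ≡ v)) → ind (inA? w) ≤ ind w≟v + ind (adj? G v w)
      go (yes _)  = ≤-trans (ind≤1 (inA? w)) (m≤m+n 1 _)
      go (no w≢v) = ind-mono (inA? w) (adj? G v w) (A-adj (w≢v ∘ sym) inA)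
    -- A is a clique with more than `d` vertices.
    d≤degree-A : InA n d ℓ v → d ≤ degree G v
    d≤degree-A inA = s≤s⁻¹ (begin
      suc d                             ≤⟨ d<a ⟩
      a                                 ≡⟨ #-< a≤n ⟨
      # inA?                            ≤⟨ ∑-mono (allFin n) (λ {w} _ → pointwise inA w) ⟩
      ∑ (allFin n) (λ w → ind (w Fin.≟ v) + ind (adj? G v w))
                                        ≡⟨ ∑-+ (allFin n) _ _ ⟩
      # (Fin._≟ v) + # (adj? G v)       ≡⟨ cong₂ _+_ (#-≡ v) (sym (degree-# G v)) ⟩
      suc (degree G v)                  ∎)

  d≤δ : d ≤ δ G
  d≤δ = v≤min⁺ d≤n (All.map⁺ {xs = allFin n} (All.tabulate λ {v} _ → d≤degree v))

  news : List (Fin n)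
  news = filter new? (allFin n)

  ∈-news⁻ : ∀ {v} → v ∈ news → New n d ℓ v
  ∈-news⁻ v∈ = proj₂ (∈-filter⁻ new? {xs = allFin n} v∈)

  news-unique : Unique news
  news-unique = Unique.filter⁺ new? (Unique.allFin⁺ n)

  ∣news∣ : length news ≡ d ∸ ℓ
  ∣news∣ = trans (length-filter new? (allFin n)) #new

  N-H-upper : ∀ r → N G (suc r) ≤ hᵣ (suc r) n d ℓ
  N-H-upper r = subst (N G (suc r) ≤_)
    (trans (cong (λ t → ((n ∸ t) C suc r) + t * (d C r)) ∣news∣) (cong (λ t → (t C suc r) + (d ∸ ℓ) * (d C r)) a≡))
    (N-upper G news news-unique (≤-reflexive ∘ degree-new ∘ ∈-news⁻) r)

  -- Subsets of A, and new vertices joined to subsets of B, are cliques; no clique is counted twice,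
  -- since those of the second kind contain exactly one new vertex.
  N-H-lower : ∀ r → hᵣ (suc r) n d ℓ ≤ N G (suc r)
  N-H-lower r = begin
    (a C suc r) + (d ∸ ℓ) * (d C r)
      ≡⟨ cong₂ (λ s t → (s C suc r) + t * (d C r)) (#-< a≤n) ∣news∣ ⟨
    (# inA? C suc r) + length news * (d C r)
      ≡⟨ cong ((# inA? C suc r) +_) (∑-const news (d C r)) ⟨
    (# inA? C suc r) + ∑ news (λ _ → d C r)
      ≤⟨ +-monoʳ-≤ (# inA? C suc r) (∑-mono news λ v∈ → ≤-reflexive (sym (links (∈-news⁻ v∈)))) ⟩
    (# inA? C suc r) + ∑ news (λ v → ∑ (subsets n) (ind ∘ linked? inB? v (suc r)))
      ≡⟨ cong₂ _+_ (count-within inA? (suc r)) (∑-swap (subsets n) news _) ⟨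
    ∑ (subsets n) (ind ∘ sized? inA? (suc r)) + ∑ (subsets n) (λ S → ∑ news (λ v → ind (linked? inB? v (suc r) S)))
      ≡⟨ ∑-+ (subsets n) _ _ ⟨
    ∑ (subsets n) (λ S → ind (sized? inA? (suc r) S) + ∑ news (λ v → ind (linked? inB? v (suc r) S)))
      ≤⟨ ∑-mono (subsets n) (λ {S} _ → pointwise S) ⟩
    ∑ (subsets n) (ind ∘ clique? G (suc r))
      ≡⟨ N-∑ G (suc r) ⟨
    N G (suc r)
      ∎
    where
    open ≤-Reasoning
    links : ∀ {v} → New n d ℓ v → ∑ (subsets n) (ind ∘ linked? inB? v (suc r)) ≡ d C r
    links new = trans (count-linked inB? (new ∘ B⇒A) r) (cong (_C r) (#-< d≤n))
    A-clique : ∀ {S} → Within (InA n d ℓ) S → IsClique G S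
    A-clique w u v u∈ v∈ u≢v = A-adj u≢v (w u u∈) (w v v∈)
    link-clique : ∀ {S v} → New n d ℓ v → Link (InB n d ℓ) v S → IsClique G S
    link-clique new (_ , w) x y x∈ y∈ x≢y = case w x x∈ , w y y∈ of λ where
      (inj₁ refl , inj₁ refl) → contradiction refl x≢y
      (inj₁ refl , inj₂ inB)  → new-adj new inB
      (inj₂ inB  , inj₁ refl) → Graph.sym G (new-adj new inB)
      (inj₂ inB  , inj₂ inB′) → A-adj x≢y (B⇒A inB) (B⇒A inB′)
    pointwise : ∀ S → ind (sized? inA? (suc r) S) + ∑ news (λ v → ind (linked? inB? v (suc r) S))
                      ≤ ind (clique? G (suc r) S)
    pointwise S with any? (λ v → linked? inB? v (suc r) S) news
    ... | no none = begin
      ind (sized? inA? (suc r) S) + ∑ news (λ v → ind (linked? inB? v (suc r) S))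
        ≤⟨ +-monoʳ-≤ (ind (sized? inA? (suc r) S)) (∑-mono news λ {v} v∈ →
             ≤-reflexive (ind-no (linked? inB? v (suc r) S) (none ∘ lose v∈))) ⟩
      ind (sized? inA? (suc r) S) + ∑ news (λ _ → 0)
        ≡⟨ trans (cong (ind (sized? inA? (suc r) S) +_) (∑-zero news λ _ → refl)) (+-identityʳ _) ⟩
      ind (sized? inA? (suc r) S)
        ≤⟨ ind-mono (sized? inA? (suc r) S) (clique? G (suc r) S) (λ (size , w) → size , A-clique w) ⟩
      ind (clique? G (suc r) S)
        ∎
    ... | yes some with find some
    -- As `S` contains the new vertex `v`, it is not inside A; its other vertices are in B, so no
    -- other new vertex contributes.
    ... | v , v∈ , size , link@(v∈S , w) = begin
      ind (sized? inA? (suc r) S) + ∑ news (λ v′ → ind (linked? inB? v′ (suc r) S))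
        ≡⟨ cong (_+ ∑ news (λ v′ → ind (linked? inB? v′ (suc r) S)))
             (ind-no (sized? inA? (suc r) S) λ (_ , w′) → ∈-news⁻ v∈ (w′ v v∈S)) ⟩
      ∑ news (λ v′ → ind (linked? inB? v′ (suc r) S))
        ≤⟨ ∑-mono news (λ {v′} v′∈ → ind-mono (linked? inB? v′ (suc r) S) (v′ Fin.≟ v)
             λ (_ , v′∈S , _) → [ id , (λ inB → contradiction (B⇒A inB) (∈-news⁻ v′∈)) ]′ (w v′ v′∈S)) ⟩
      ∑ news (ind ∘ (Fin._≟ v))
        ≤⟨ ∑-⊆ news-unique (λ {v′} _ → ∈-allFin v′) ⟩
      # (Fin._≟ v)
        ≡⟨ #-≡ v ⟩
      1
        ≡⟨ ind-yes (clique? G (suc r) S) (size , link-clique (∈-news⁻ v∈) link) ⟨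
      ind (clique? G (suc r) S)
        ∎

  -- Non-hamiltonicity of H

  private
    -- A path with ℓ edges takes ℓ + 1 vertices, and B has that many because `ℓ < d`.
    ps : List (Fin n)
    ps = take (suc ℓ) (filter inB? (allFin n))

    ps-unique : Unique ps
    ps-unique = Unique.take⁺ (suc ℓ) (Unique.filter⁺ inB? (Unique.allFin⁺ n))

    ps⇒B : ∀ {v} → v ∈ ps → InB n d ℓ v
    ps⇒B v∈ = proj₂ (∈-filter⁻ inB? {xs = allFin n} (∈-take (suc ℓ) v∈))

    ∣ps∣ : length ps ≡ suc ℓ
    ∣ps∣ = trans (length-take (suc ℓ) (filter inB? (allFin n)))
      (m≤n⇒m⊓n≡m (≤-trans ℓ<d (≤-reflexive (sym (trans (length-filter inB? (allFin n)) (#-< d≤n))))))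

  open PathForest ps-unique renaming (pathGraph to F)

  ∣E-F∣ : ∣E F ∣ ≡ ℓ
  ∣E-F∣ = trans ∣E∣≡arcs (len ps ∣ps∣)
    where
    len : ∀ qs → length qs ≡ suc ℓ → length (arcs qs) ≡ ℓ
    len (q ∷ qs) eq = trans (length-arcs q qs) (suc-injective eq)

  F⇒B : ∀ {u v} → Adj F u v → InB n d ℓ u × InB n d ℓ v
  F⇒B (inj₁ st) = ps⇒B (step-∈ˡ st) , ps⇒B (step-∈ʳ st)
  F⇒B (inj₂ st) = ps⇒B (step-∈ʳ st) , ps⇒B (step-∈ˡ st)

  F⊆H : F ⊆ᴳ G
  F⊆H {u} {v} uv = let inB , inB′ = F⇒B uv in
    A-adj (λ u≡v → Graph.irrefl F u≡v uv) (B⇒A inB) (B⇒A inB′)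

  ¬hamiltonian : ¬ Hamiltonian ℓ G
  ¬hamiltonian ham with ham F isForest ∣E-F∣ F⊆H
  ... | c , traversed = proj₂ (All.lookup all-outside (∈-++⁺ˡ (spanning v₀))) (subst (_< d) (sym (toℕ-fromℕ< 0<n)) 0<d)
    where
    open HamiltonianCycle c using (start; rest; distinct; spanning; adjacent)
    W = closedWalk c
    0<d : 0 < d
    0<d = ≤-trans (s≤s z≤n) ℓ<d
    0<n : 0 < n
    0<n = ≤-trans 0<d d≤n
    v₀ v₁ : Fin n
    v₀ = fromℕ< 0<n
    v₁ = fromℕ< (d<n ℓ<d 2d<n+ℓ)
    around : (f : Fin n → ℕ) → ∑ (start ∷ rest) f ≡ ∑ (allFin n) f
    around f = ∑-≈ distinct (Unique.allFin⁺ n) (λ {v} _ → ∈-allFin v) (λ {v} _ → spanning v)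
    -- `f` counts the reasons for an arc to end in B: its source is new, or it is an edge of `F`.
    -- The two exclude each other, since the ends of `F`-edges lie in B, so `f` is at most `g` on
    -- every arc.
    f g : Fin n × Fin n → ℕ
    f (x , y) = ind (new? x) + ind (adj? F x y)
    g (x , y) = ind (inB? y)
    f≤g : ∀ {e} → e ∈ arcs W → f e ≤ g e
    f≤g {x , y} e∈ with new? x
    ... | yes new = ≤-reflexive (trans
      (cong suc (ind-no (adj? F x y) λ xy → new (B⇒A (proj₁ (F⇒B xy)))))
      (sym (ind-yes (inB? y) (new-adj⇒B new (linked⇒step adjacent (∈-arcs⁻ W e∈))))))
    ... | no _ = ind-mono (adj? F x y) (inB? y) (proj₂ ∘ F⇒B)
    -- Each vertex is the target of one arc, giving d for `g`; each is the source of one, giving d -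
    -- ℓ for the new vertices, and the edges of `F` add at least ℓ.
    ∑g≤∑f : ∑ (arcs W) g ≤ ∑ (arcs W) f
    ∑g≤∑f = begin
      ∑ (arcs W) g                                   ≡⟨ ∑-closed-target start rest (ind ∘ inB?) ⟩
      ∑ (start ∷ rest) (ind ∘ inB?)                  ≡⟨ trans (around (ind ∘ inB?)) (#-< d≤n) ⟩
      d                                              ≡⟨ m∸n+n≡m (<⇒≤ ℓ<d) ⟨
      d ∸ ℓ + ℓ                                      ≡⟨ cong₂ _+_ (trans (around (ind ∘ new?)) #new) ∣E-F∣ ⟨
      ∑ (start ∷ rest) (ind ∘ new?) + ∣E F ∣         ≤⟨ +-monoʳ-≤ (∑ (start ∷ rest) (ind ∘ new?)) (edges-≤-arcs F traversed) ⟩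
      ∑ (start ∷ rest) (ind ∘ new?) + ∑ (arcs W) (λ (x , y) → ind (adj? F x y))
        ≡⟨ cong (_+ ∑ (arcs W) (λ (x , y) → ind (adj? F x y))) (∑-closed-source (start ∷ rest) start (ind ∘ new?)) ⟨
      ∑ (arcs W) (λ (x , y) → ind (new? x)) + ∑ (arcs W) (λ (x , y) → ind (adj? F x y))
        ≡⟨ ∑-+ (arcs W) _ _ ⟨
      ∑ (arcs W) f                                   ∎
      where open ≤-Reasoning hiding (start)
    Outside : Fin n → Set
    Outside v = InA n d ℓ v × ¬ InB n d ℓ v
    -- An arc leaving A outside B has `f` equal to 0, hence by tightness `g` equal to 0, so it does
    -- not end in B. It cannot end in a new vertex either, whose neighbours are all in B.
    closed : ∀ {x y} → Step x y W → Outside x → Outside y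
    closed {x} {y} st (inA , ¬inB) = inA′ (linked⇒step adjacent st) , λ inB →
      contradiction (trans (sym f≡0) (trans (∑-tight f≤g ∑g≤∑f (∈-arcs⁺ st)) (ind-yes (inB? y) inB))) λ ()
      where
      f≡0 : f (x , y) ≡ 0
      f≡0 = cong₂ _+_ (ind-no (new? x) (λ new → new inA)) (ind-no (adj? F x y) (¬inB ∘ proj₁ ∘ F⇒B))
      inA′ : Adj G x y → InA n d ℓ y
      inA′ (_ , inj₁ (_ , a))        = a
      inA′ (_ , inj₂ (inj₁ (b , _))) = contradiction b ¬inB
      inA′ (_ , inj₂ (inj₂ (new , _))) = contradiction inA new
    outside₁ : Outside v₁
    outside₁ = subst (_< a) (sym (toℕ-fromℕ< _)) d<a , λ lt → <-irrefl refl (subst (_< d) (toℕ-fromℕ< _) lt)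
    all-outside : All Outside W
    all-outside = closed-all (rest ∷ʳ start) closed (closed-last (start ∷ rest) closed (spanning v₁) outside₁)

N-H : {n d ℓ : ℕ} → ℓ < d → d + d < n + ℓ → ∀ r → N (H n d ℓ) (suc r) ≡ hᵣ (suc r) n d ℓ
N-H ℓ<d 2d<n+ℓ r = ≤-antisym (N-H-upper r) (N-H-lower r)
  where open Extremal ℓ<d 2d<n+ℓ

theorem4 : (n d r ℓ : ℕ) → 2 ≤ r → ℓ < d → d ≤ ⌊ n + ℓ ∸ 1 /2⌋ →
    ((G : Graph n) → d ≤ δ G → ¬ Hamiltonian ℓ G →
    (N G r ≤ hᵣ r n d ℓ ⊔ hᵣ r n ⌊ n + ℓ ∸ 1 /2⌋ ℓ) ×
    (∣E G ∣ ≤ h n d ℓ ⊔ h n ⌊ n + ℓ ∸ 1 /2⌋ ℓ))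
    ×
    (d ≤ δ (H n d ℓ) × ¬ Hamiltonian ℓ (H n d ℓ))
    ×
    (d ≤ δ (H n ⌊ n + ℓ ∸ 1 /2⌋ ℓ) × ¬ Hamiltonian ℓ (H n ⌊ n + ℓ ∸ 1 /2⌋ ℓ))
    ×
    (N (H n d ℓ) r ≡ hᵣ r n d ℓ ⊔ hᵣ r n ⌊ n + ℓ ∸ 1 /2⌋ ℓ
    ⊎
    N (H n ⌊ n + ℓ ∸ 1 /2⌋ ℓ) r ≡ hᵣ r n d ℓ ⊔ hᵣ r n ⌊ n + ℓ ∸ 1 /2⌋ ℓ)
theorem4 n d (suc r) ℓ (s≤s 1≤r) ℓ<d d≤m =
    (λ G d≤δ ¬ham → N-≤-bound ℓ<d 2d<n+ℓ r 1≤r G d≤δ ¬ham ,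
                    ≤-trans (∣E∣≤N₂ G) (N-≤-bound ℓ<d 2d<n+ℓ 1 ≤-refl G d≤δ ¬ham))
  , (Hd.d≤δ , Hd.¬hamiltonian)
  , (≤-trans d≤m Hm.d≤δ , Hm.¬hamiltonian)
  , Sum.map (trans (N-H ℓ<d 2d<n+ℓ r) ∘ sym) (trans (N-H ℓ<m 2m<n+ℓ r) ∘ sym)
      (⊔-sel (hᵣ (suc r) n d ℓ) (hᵣ (suc r) n m ℓ))
  where
  m = ⌊ n + ℓ ∸ 1 /2⌋
  ℓ<m : ℓ < m
  ℓ<m = <-≤-trans ℓ<d d≤m
  -- Since k is positive, so is n + ℓ; the subtraction of 1 is therefore not truncated and makes the
  -- inequality strict.
  double-< : ∀ {k} → ℓ < k → k ≤ m → k + k < n + ℓ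
  double-< {suc k} _ k≤m = ≤∸1⇒< (double k≤m)
    where
    ≤∸1⇒< : ∀ {j t} → suc j ≤ t ∸ 1 → suc (suc j) ≤ t
    ≤∸1⇒< {t = suc t} j<t = s≤s j<t
  2d<n+ℓ : d + d < n + ℓ
  2d<n+ℓ = double-< ℓ<d d≤m
  2m<n+ℓ : m + m < n + ℓ
  2m<n+ℓ = double-< ℓ<m ≤-refl
  module Hd = Extremal ℓ<d 2d<n+ℓ
  module Hm = Extremal ℓ<m 2m<n+ℓ
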